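{- For every integer $a\ge 2$, the spider graph $S(a,2,1)$ is Schur positive, i.e., every coefficient of its chromatic symmetric function $X_{S(a,2,1)}$ in the Schur basis $\{s_\lambda\}$ is nonnegative.
   Context: For a simple graph $G$ with vertex set $\{v_1,v_2,\dots\}$, the chromatic symmetric function is $X_G(x_1,x_2,\dots)=\sum_{c} x_{c(v_1)}x_{c(v_2)}\cdots$, the sum over all proper colorings $c\colon V(G)\to\{1,2,3,\dots\}$ (adjacent vertices receive different colors). $G$ is Schur positive if all coefficients of $X_G$ in the basis of Schur functions are nonnegative. For a partition $\lambda=(\lambda_1,\lambda_2,\dots)$ of $n-1$, the spider $S(\lambda)$ is the tree on $n$ vertices obtained by taking paths $P_{\lambda_1+1},P_{\lambda_2+1},\dots$ (where $P_m$ is the path on $m$ vertices) and identifying one end vertex of each of them into a single vertex. Thus $S(a,2,1)$ has $a+4$ vertices. -}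

module Defs where

open import Data.Nat using (ℕ; zero; suc; _+_; _*_; _≡ᵇ_; _<ᵇ_; _≤ᵇ_)
open import Data.Bool using (Bool; true; false; _∧_; _∨_; not)
open import Data.List using (List; []; _∷_; map; concatMap; concat; upTo; allFin; filterᵇ; length)
open import Data.Nat.ListAction using (sum)
open import Data.Bool.ListAction using (all; any)
open import Data.Fin using (Fin; toℕ)
import Data.List
open import Data.Product using (Σ)
open import Relation.Binary.PropositionalEquality using (_≡_)

-- Simple graphs on vertex set {0,…,n-1}, with a Boolean adjacency
-- relation (only its values on vertices < n matter).

record Graph : Set where
  field
    size : ℕ
    adj  : ℕ → ℕ → Bool
open Graph public

-- Spiders.  For leg lengths λ = (λ₁,…,λₖ), S(λ) has vertex 0 as centre
-- and 1 + sum λ vertices; leg i occupies a block of λᵢ consecutive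
-- labels starting at s_i (s₁ = 1, s_{i+1} = s_i + λ_i), forming the path
-- 0 – s_i – s_i+1 – … – s_i+λ_i-1.

legStarts : ℕ → List ℕ → List ℕ
legStarts s []      = []
legStarts s (l ∷ ls) = s ∷ legStarts (s + l) ls

isStart : List ℕ → ℕ → Bool
isStart ls v = any (λ s → s ≡ᵇ v) (legStarts 1 ls)

spiderAdj' : List ℕ → ℕ → ℕ → Bool
spiderAdj' ls u v =
  ((u ≡ᵇ 0) ∧ isStart ls v) ∨ ((1 ≤ᵇ u) ∧ (v ≡ᵇ suc u) ∧ not (isStart ls v))

spider : List ℕ → Graph
spider ls = record
  { size = suc (sum ls)
  ; adj  = λ u v → spiderAdj' ls u v ∨ spiderAdj' ls v u }

words : ℕ → ℕ → List (List ℕ)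
words N zero    = [] ∷ []
words N (suc n) = concatMap (λ c → map (c ∷_) (words N n)) (upTo N)

at : List ℕ → ℕ → ℕ
at []       _       = 0
at (x ∷ xs) zero    = x
at (x ∷ xs) (suc i) = at xs i

count : (List ℕ → Bool) → List (List ℕ) → ℕ
count p xs = length (filterᵇ p xs)

mult : List ℕ → ℕ → ℕ
mult xs k = length (filterᵇ (λ x → x ≡ᵇ k) xs)

hasContent : (N : ℕ) → (Fin N → ℕ) → List ℕ → Bool
hasContent N α xs = all (λ i → mult xs (toℕ i) ≡ᵇ α i) (allFin N)

-- Chromatic symmetric function, in N variables x₀,…,x_{N-1}:
-- the coefficient of x^α in X_G(x₀,…,x_{N-1}) is the number of proper
-- colourings c : V(G) → {0,…,N-1} with |c⁻¹(i)| = α i for all i.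
-- A colouring is a list c of length (size G), vertex v gets colour at c v.

proper : Graph → List ℕ → Bool
proper G c =
  all (λ u → all (λ v → not (adj G u v) ∨ not (at c u ≡ᵇ at c v))
                 (upTo (size G)))
      (upTo (size G))

chromCoeff : Graph → (N : ℕ) → (Fin N → ℕ) → ℕ
chromCoeff G N α = count (λ c → proper G c ∧ hasContent N α c) (words N (size G))

weaklyDecr : List ℕ → Bool
weaklyDecr []           = true
weaklyDecr (x ∷ [])     = true
weaklyDecr (x ∷ y ∷ xs) = (y ≤ᵇ x) ∧ weaklyDecr (y ∷ xs)

isPartitionOf : ℕ → List ℕ → Bool
isPartitionOf n λs = weaklyDecr λs ∧ all (λ x → 1 ≤ᵇ x) λs ∧ (sum λs ≡ᵇ n)

partitions : ℕ → List (List ℕ)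
partitions n =
  filterᵇ (isPartitionOf n) (concatMap (λ k → words (suc n) k) (upTo (suc n)))

sumOver : List (List ℕ) → (List ℕ → ℕ) → ℕ
sumOver xs f = sum (map f xs)

-- Schur functions in N variables: s_λ(x₀,…,x_{N-1}) = Σ_T x^{content T}
-- over semistandard Young tableaux T of shape λ with entries in
-- {0,…,N-1}.  A filling is a list of rows (English notation); the
-- coefficient of x^α in s_λ is the Kostka number below.

fillings : ℕ → List ℕ → List (List (List ℕ))
fillings N []       = [] ∷ []
fillings N (r ∷ rs) = concatMap (λ row → map (row ∷_) (fillings N rs)) (words N r)

colStrict : List ℕ → List ℕ → Bool
colStrict _        []       = true
colStrict []       (_ ∷ _)  = false
colStrict (x ∷ xs) (y ∷ ys) = (x <ᵇ y) ∧ colStrict xs ys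

semistandard : List (List ℕ) → Bool
semistandard []            = true
semistandard (r ∷ [])      = weaklyDecr (Data.List.reverse r)
semistandard (r ∷ r' ∷ rs) = weaklyDecr (Data.List.reverse r) ∧ colStrict r r' ∧ semistandard (r' ∷ rs)

kostka : List ℕ → (N : ℕ) → (Fin N → ℕ) → ℕ
kostka λs N α =
  length (filterᵇ (λ T → semistandard T ∧ hasContent N α (concat T)) (fillings N λs))

-- G is Schur positive: X_G = Σ_{λ ⊢ |V(G)|} c_λ s_λ with all c_λ ∈ ℕ,
-- as an identity of symmetric functions, i.e. coefficientwise in
-- x₀,…,x_{N-1} for every number N of variables.

SchurPositive : Graph → Set
SchurPositive G =
  Σ (List ℕ → ℕ) λ c → (N : ℕ) → (α : Fin N → ℕ) →
    chromCoeff G N α ≡ sumOver (partitions (size G)) (λ λs → c λs * kostka λs N α)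

{-# OPTIONS --safe #-}

-- Write p_n for the chromatic symmetric function of the path on n vertices.  Fixing the colour of the
-- centre gives X = p_{a+4} + p_1 p_{a+3} - p_3 p_{a+1} for S(a,2,1), and
-- p_n = Σ_{i=2}^{n-1} (i-1) e_i p_{n-i} + n e_n.  Expanding the three products, the only negative
-- term left is -e_3 p_{a+1}, and it is absorbed by the term 2 e_1 e_3 p_a: the differences
-- D_m = 2 e_1 p_{m-1} - p_m satisfy
--   D_m = Σ_{i=2}^{m-2} (i-1) e_i D_{m-i} + m (e_1 e_{m-1} - e_m),
-- where e_1 e_{m-1} - e_m is the Schur function of the hook (2,1^{m-2}).  So X is a sum of products
-- of elementary symmetric functions and at most one hook Schur function, which are Schur positive by
-- the Pieri rule.
--
-- A symmetric function is handled through its values at all integer weights x 0, …, x (N-1).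

module Submission where

open import Defs
open import Data.Nat as ℕ using (ℕ; zero; suc; _≤_; _<_; z≤n; s≤s; _≤ᵇ_; _<ᵇ_; _≡ᵇ_; _∸_; _^_; NonZero)
import Data.Nat.Properties as ℕₚ
open import Data.Nat.DivMod using (_%_; _/_; [m+kn]%n≡m%n; m<n⇒m%n≡m; m<n⇒m/n≡0; +-distrib-/-∣ʳ; m*n/n≡m)
open import Data.Nat.Divisibility using (n∣m*n)
open import Data.Nat.Induction using (<-rec)
open import Data.Nat.ListAction using (sum)
open import Data.Integer using (ℤ; 0ℤ; 1ℤ; _+_; _*_; _-_; -_)
open import Data.Integer.Properties using (+-identityˡ; +-identityʳ; +-assoc; +-injective; *-zeroˡ; *-zeroʳ; *-identityˡ; *-identityʳ; *-assoc; *-comm; *-distribˡ-+; pos-+; pos-*)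
open import Data.Integer.Tactic.RingSolver using (solve-∀)
open import Data.Bool using (Bool; true; false; T; _∧_; _∨_; not; if_then_else_)
open import Data.Bool.ListAction using (all)
open import Data.Bool.Properties using (T-∧; T-∨; T?; ∧-assoc; ∧-comm; ∧-identityʳ)
open import Data.Fin using (toℕ)
open import Data.List using (List; []; _∷_; _++_; _∷ʳ_; _ʳ++_; allFin; concat; concatMap; filter; filterᵇ; length; map; replicate; reverse; upTo)
open import Data.List.Properties using (length-filter; length-map; upTo-∷ʳ)
open import Data.List.Relation.Unary.All as All using (All; []; _∷_)
open import Data.List.Relation.Unary.All.Properties using (++⁺; all⁺; all⁻; applyUpTo⁺₁; applyUpTo⁻; map⁺; map⁻; replicate⁺)
open import Data.Empty using (⊥; ⊥-elim)
open import Data.Product using (Σ; _×_; _,_; proj₁; proj₂)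
open import Data.Sum using (_⊎_; inj₁; inj₂; [_,_])
open import Data.Unit using (⊤; tt)
open import Function using (_∘_; const; id; Equivalence)
open import Relation.Binary using (tri<; tri≈; tri>)
open import Relation.Binary.PropositionalEquality using (_≡_; _≢_; refl; sym; trans; cong; cong₂; subst; module ≡-Reasoning)
open import Relation.Nullary using (¬_; yes; no; Dec)
open import Relation.Nullary.Decidable using (_×-dec_)
open ≡-Reasoning
open Equivalence using (to; from)
open ℤ using (pos)

-- Finite sums

-- The path recurrence comes from generating functions. Let E(z) = Σ e_k z^k and P(z) = Σ p_n z^n.
-- The legs below a vertex of colour c have series P/(1 + x_c z), and E/(1 + x_c z) is E with the
-- variable x_c left out. Summing over c gives E (P - 1) = z E' P, which is used in this cleared
-- form, as an identity of convolutions. The recurrence is linear in p, so D inherits it with the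
-- same kernel (i-1) e_i, and the positivity of D is decided by the boundary terms alone. The Pieri
-- rule is proved by induction on the number of variables rather than by insertion into tableaux.
-- Splitting off the last variable x turns e_k into e_k + x e_{k-1} and s_λ into a sum over
-- horizontal strips, so it suffices that adding a vertical strip and removing a horizontal strip
-- commute up to one term with factor x. Both operations act on arbitrary functions of shapes, so an
-- induction over rows can fix the first row and continue with a function of the remaining ones.

when : Bool → ℤ → ℤ
when true  v = v
when false v = 0ℤ

when-true : ∀ {b} v → b ≡ true → when b v ≡ v
when-true v refl = refl

when-false : ∀ {b} v → b ≡ false → when b v ≡ 0ℤ
when-false v refl = refl

when-∧ : ∀ b c v → when (b ∧ c) v ≡ when b (when c v)
when-∧ true  c v = refl
when-∧ false c v = refl

when-* : ∀ b u v → u * when b v ≡ when b (u * v)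
when-* true  u v = refl
when-* false u v = *-zeroʳ u

when-+ : ∀ b u v → when b (u + v) ≡ when b u + when b v
when-+ true  u v = refl
when-+ false u v = refl

+-interchange : ∀ a b c d → (a + b) + (c + d) ≡ (a + c) + (b + d)
+-interchange = solve-∀

*-left-comm : ∀ a b c → a * (b * c) ≡ b * (a * c)
*-left-comm = solve-∀

∑ : {A : Set} → List A → (A → ℤ) → ℤ
∑ []       f = 0ℤ
∑ (x ∷ xs) f = f x + ∑ xs f

module _ {A : Set} where

  ∑-cong : ∀ (xs : List A) {f g : A → ℤ} → (∀ a → f a ≡ g a) → ∑ xs f ≡ ∑ xs g
  ∑-cong []       h = refl
  ∑-cong (x ∷ xs) h = cong₂ _+_ (h x) (∑-cong xs h)

  ∑-0 : ∀ (xs : List A) → ∑ xs (λ _ → 0ℤ) ≡ 0ℤ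
  ∑-0 []       = refl
  ∑-0 (x ∷ xs) = trans (+-identityˡ _) (∑-0 xs)

  ∑-when : ∀ (xs : List A) b (f : A → ℤ) → ∑ xs (λ a → when b (f a)) ≡ when b (∑ xs f)
  ∑-when xs true  f = refl
  ∑-when xs false f = ∑-0 xs

  ∑-+ : ∀ (xs : List A) (f g : A → ℤ) → ∑ xs (λ a → f a + g a) ≡ ∑ xs f + ∑ xs g
  ∑-+ []       f g = refl
  ∑-+ (x ∷ xs) f g = trans (cong ((f x + g x) +_) (∑-+ xs f g)) (+-interchange (f x) (g x) (∑ xs f) (∑ xs g))

  ∑-* : ∀ (xs : List A) (c : ℤ) (f : A → ℤ) → ∑ xs (λ a → c * f a) ≡ c * ∑ xs f
  ∑-* []       c f = sym (*-zeroʳ c)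
  ∑-* (x ∷ xs) c f = trans (cong (c * f x +_) (∑-* xs c f)) (sym (*-distribˡ-+ c (f x) (∑ xs f)))

  ∑-++ : ∀ (xs ys : List A) (f : A → ℤ) → ∑ (xs ++ ys) f ≡ ∑ xs f + ∑ ys f
  ∑-++ []       ys f = sym (+-identityˡ _)
  ∑-++ (x ∷ xs) ys f = trans (cong (f x +_) (∑-++ xs ys f)) (sym (+-assoc (f x) (∑ xs f) (∑ ys f)))

  ∑-map : ∀ {B : Set} (h : B → A) (xs : List B) (f : A → ℤ) → ∑ (map h xs) f ≡ ∑ xs (f ∘ h)
  ∑-map h []       f = refl
  ∑-map h (x ∷ xs) f = cong (f (h x) +_) (∑-map h xs f)

  ∑-concatMap : ∀ {B : Set} (h : B → List A) (xs : List B) (f : A → ℤ) →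
                ∑ (concatMap h xs) f ≡ ∑ xs (λ b → ∑ (h b) f)
  ∑-concatMap h []       f = refl
  ∑-concatMap h (x ∷ xs) f = trans (∑-++ (h x) (concatMap h xs) f) (cong (∑ (h x) f +_) (∑-concatMap h xs f))

  ∑-filter : ∀ (p : A → Bool) (xs : List A) (f : A → ℤ) → ∑ (filterᵇ p xs) f ≡ ∑ xs (λ a → when (p a) (f a))
  ∑-filter p []       f = refl
  ∑-filter p (x ∷ xs) f with p x
  ... | true  = cong (f x +_) (∑-filter p xs f)
  ... | false = trans (∑-filter p xs f) (sym (+-identityˡ _))

∑< : ℕ → (ℕ → ℤ) → ℤ
∑< zero    f = 0ℤ
∑< (suc N) f = ∑< N f + f N

∑-upTo : ∀ N f → ∑ (upTo N) f ≡ ∑< N f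
∑-upTo zero    f = refl
∑-upTo (suc N) f = begin
  ∑ (upTo (suc N)) f            ≡⟨ cong (λ l → ∑ l f) (sym (upTo-∷ʳ N)) ⟩
  ∑ (upTo N ++ N ∷ []) f        ≡⟨ ∑-++ (upTo N) (N ∷ []) f ⟩
  ∑ (upTo N) f + (f N + 0ℤ)     ≡⟨ cong₂ _+_ (∑-upTo N f) (+-identityʳ (f N)) ⟩
  ∑< N f + f N                  ∎
  where open ≡-Reasoning

∑<-cong : ∀ N {f g : ℕ → ℤ} → (∀ c → c < N → f c ≡ g c) → ∑< N f ≡ ∑< N g
∑<-cong zero    h = refl
∑<-cong (suc N) h = cong₂ _+_ (∑<-cong N (λ c c<N → h c (ℕₚ.m<n⇒m<1+n c<N))) (h N (ℕₚ.n<1+n N))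

∑<-0 : ∀ N → ∑< N (λ _ → 0ℤ) ≡ 0ℤ
∑<-0 zero    = refl
∑<-0 (suc N) = trans (+-identityʳ _) (∑<-0 N)

∑<-+ : ∀ N (f g : ℕ → ℤ) → ∑< N (λ c → f c + g c) ≡ ∑< N f + ∑< N g
∑<-+ zero    f g = refl
∑<-+ (suc N) f g = trans (cong (_+ (f N + g N)) (∑<-+ N f g)) (+-interchange (∑< N f) (∑< N g) (f N) (g N))

∑<-* : ∀ N k (f : ℕ → ℤ) → ∑< N (λ c → k * f c) ≡ k * ∑< N f
∑<-* zero    k f = sym (*-zeroʳ k)
∑<-* (suc N) k f = trans (cong (_+ (k * f N)) (∑<-* N k f)) (sym (*-distribˡ-+ k (∑< N f) (f N)))

-- The Pieri rule

≤⇒≤ᵇ≡true : ∀ {m n} → m ≤ n → (m ≤ᵇ n) ≡ true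
≤⇒≤ᵇ≡true {m} {n} m≤n with m ≤ᵇ n | ℕₚ.≤⇒≤ᵇ m≤n
... | true | _ = refl

>⇒≤ᵇ≡false : ∀ {m n} → n < m → (m ≤ᵇ n) ≡ false
>⇒≤ᵇ≡false {m} {n} n<m with m ≤ᵇ n in eq
... | false = refl
... | true  = ⊥-elim (ℕₚ.<⇒≱ n<m (ℕₚ.≤ᵇ⇒≤ m n (subst T (sym eq) tt)))

Shape : Set
Shape = List ℕ

hd : Shape → ℕ
hd []      = 0
hd (a ∷ _) = a

IsPart : Shape → Set
IsPart []       = ⊤
IsPart (a ∷ λs) = hd λs ≤ a × IsPart λs

-- Multiplication by e_k on the Schur basis: V k F λ is the sum of F over the shapes obtained
-- from λ by adding a vertical strip of size k (some of which are not partitions).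
V  : ℕ → (Shape → ℤ) → Shape → ℤ
V⁻ : ℕ → (Shape → ℤ) → Shape → ℤ
V k F []       = F (replicate k 1)
V k F (a ∷ λs) = V k (F ∘ (a ∷_)) λs + V⁻ k (F ∘ (suc a ∷_)) λs
V⁻ zero    F λs = 0ℤ
V⁻ (suc k) F λs = V k F λs

V-ext  : ∀ k λs {F G : Shape → ℤ} → (∀ μ → F μ ≡ G μ) → V k F λs ≡ V k G λs
V⁻-ext : ∀ k λs {F G : Shape → ℤ} → (∀ μ → F μ ≡ G μ) → V⁻ k F λs ≡ V⁻ k G λs
V-ext k []       h = h (replicate k 1)
V-ext k (a ∷ λs) h = cong₂ _+_ (V-ext k λs (h ∘ (a ∷_))) (V⁻-ext k λs (h ∘ (suc a ∷_)))
V⁻-ext zero    λs h = refl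
V⁻-ext (suc k) λs h = V-ext k λs h

hd-column : ∀ k → hd (replicate k 1) ≤ 1
hd-column zero    = z≤n
hd-column (suc k) = ℕₚ.≤-refl

-- A vertical strip has at most one box in each row. The resulting bounds on the first row decide
-- the guards of horizontal strips in the commutation proof.
V-cong : ∀ k λs {F G : Shape → ℤ} → (∀ μ → hd λs ≤ hd μ → hd μ ≤ suc (hd λs) → F μ ≡ G μ) → V k F λs ≡ V k G λs
V-cong k []       h = h (replicate k 1) z≤n (hd-column k)
V-cong k (a ∷ λs) h = cong₂ _+_
  (V-ext k λs (λ μ → h (a ∷ μ) ℕₚ.≤-refl (ℕₚ.n≤1+n a)))
  (V⁻-ext k λs (λ μ → h (suc a ∷ μ) (ℕₚ.n≤1+n a) ℕₚ.≤-refl))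

V-0  : ∀ k λs → V k (λ _ → 0ℤ) λs ≡ 0ℤ
V⁻-0 : ∀ k λs → V⁻ k (λ _ → 0ℤ) λs ≡ 0ℤ
V-0 k []       = refl
V-0 k (a ∷ λs) = cong₂ _+_ (V-0 k λs) (V⁻-0 k λs)
V⁻-0 zero    λs = refl
V⁻-0 (suc k) λs = V-0 k λs

V-+  : ∀ k λs (F G : Shape → ℤ) → V k (λ μ → F μ + G μ) λs ≡ V k F λs + V k G λs
V⁻-+ : ∀ k λs (F G : Shape → ℤ) → V⁻ k (λ μ → F μ + G μ) λs ≡ V⁻ k F λs + V⁻ k G λs
V-+ k []       F G = refl
V-+ k (a ∷ λs) F G = trans
  (cong₂ _+_ (V-+ k λs (F ∘ (a ∷_)) (G ∘ (a ∷_))) (V⁻-+ k λs (F ∘ (suc a ∷_)) (G ∘ (suc a ∷_))))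
  (+-interchange (V k (F ∘ (a ∷_)) λs) (V k (G ∘ (a ∷_)) λs) _ _)
V⁻-+ zero    λs F G = refl
V⁻-+ (suc k) λs F G = V-+ k λs F G

V-*  : ∀ k λs c (F : Shape → ℤ) → V k (λ μ → c * F μ) λs ≡ c * V k F λs
V⁻-* : ∀ k λs c (F : Shape → ℤ) → V⁻ k (λ μ → c * F μ) λs ≡ c * V⁻ k F λs
V-* k []       c F = refl
V-* k (a ∷ λs) c F = trans
  (cong₂ _+_ (V-* k λs c (F ∘ (a ∷_))) (V⁻-* k λs c (F ∘ (suc a ∷_))))
  (sym (*-distribˡ-+ c (V k (F ∘ (a ∷_)) λs) (V⁻ k (F ∘ (suc a ∷_)) λs)))
V⁻-* zero    λs c F = sym (*-zeroʳ c)
V⁻-* (suc k) λs c F = V-* k λs c F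

-- J x h f = Σ_{c ≤ h} x^(h-c) f(c)
J : ℤ → ℕ → (ℕ → ℤ) → ℤ
J x zero    f = f 0
J x (suc h) f = f (suc h) + x * J x h f

module _ (x : ℤ) where

  J-cong : ∀ h {f g : ℕ → ℤ} → (∀ c → c ≤ h → f c ≡ g c) → J x h f ≡ J x h g
  J-cong zero    e = e 0 z≤n
  J-cong (suc h) e = cong₂ _+_ (e (suc h) ℕₚ.≤-refl) (cong (x *_) (J-cong h (λ c c≤h → e c (ℕₚ.m≤n⇒m≤1+n c≤h))))

  J-0 : ∀ h → J x h (λ _ → 0ℤ) ≡ 0ℤ
  J-0 zero    = refl
  J-0 (suc h) = trans (+-identityˡ _) (trans (cong (x *_) (J-0 h)) (*-zeroʳ x))

  J-+ : ∀ h (f g : ℕ → ℤ) → J x h (λ c → f c + g c) ≡ J x h f + J x h g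
  J-+ zero    f g = refl
  J-+ (suc h) f g = trans (cong (λ z → (f (suc h) + g (suc h)) + x * z) (J-+ h f g))
                          (ring (f (suc h)) (g (suc h)) x (J x h f) (J x h g))
    where
    ring : ∀ a b x c d → (a + b) + x * (c + d) ≡ (a + x * c) + (b + x * d)
    ring = solve-∀

  J-* : ∀ h k (f : ℕ → ℤ) → J x h (λ c → k * f c) ≡ k * J x h f
  J-* zero    k f = refl
  J-* (suc h) k f = trans (cong (λ z → k * f (suc h) + x * z) (J-* h k f))
                          (ring k (f (suc h)) x (J x h f))
    where
    ring : ∀ k a x b → k * a + x * (k * b) ≡ k * (a + x * b)
    ring = solve-∀

  J-V : ∀ h k λs (G : ℕ → Shape → ℤ) → V k (λ μ → J x h (λ c → G c μ)) λs ≡ J x h (λ c → V k (G c) λs)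
  J-V zero    k λs G = refl
  J-V (suc h) k λs G = begin
    V k (λ μ → G (suc h) μ + x * J x h (λ c → G c μ)) λs
      ≡⟨ V-+ k λs (G (suc h)) _ ⟩
    V k (G (suc h)) λs + V k (λ μ → x * J x h (λ c → G c μ)) λs
      ≡⟨ cong (V k (G (suc h)) λs +_) (trans (V-* k λs x _) (cong (x *_) (J-V h k λs G))) ⟩
    V k (G (suc h)) λs + x * J x h (λ c → V k (G c) λs) ∎

  J-top : ∀ h {f : ℕ → ℤ} → (∀ c → c < h → f c ≡ 0ℤ) → J x h f ≡ f h
  J-top zero    e = refl
  J-top (suc h) {f} e = begin
    f (suc h) + x * J x h f
      ≡⟨ cong (λ z → f (suc h) + x * z) (trans (J-cong h (λ c c≤h → e c (s≤s c≤h))) (J-0 h)) ⟩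
    f (suc h) + x * 0ℤ  ≡⟨ cong (f (suc h) +_) (*-zeroʳ x) ⟩
    f (suc h) + 0ℤ      ≡⟨ +-identityʳ _ ⟩
    f (suc h)           ∎

  -- The summand `x * A⁻ c` at weight x^(a-c) has the weight of index `c - 1`, so it pairs with
  -- `A (c - 1)`. The lower end is clean because `Y b` has no `A⁻` part, and the extra `A⁻ (suc a)`
  -- completes the upper end.
  J-telescope : ∀ b (Y A A⁻ : ℕ → ℤ) →
    (∀ c → c < b → Y c ≡ 0ℤ) → Y b ≡ A b → (∀ c → b < c → Y c ≡ A c + x * A⁻ c) →
    ∀ a → b ≤ a → J x a Y + A⁻ (suc a) ≡ J x a (λ c → when (b ≤ᵇ c) (A c + A⁻ (suc c)))
  J-telescope b Y A A⁻ lo mid hi a b≤a with ℕₚ.m≤n⇒m<n∨m≡n b≤a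
  ... | inj₂ refl = begin
    J x b Y + A⁻ (suc b)  ≡⟨ cong (_+ A⁻ (suc b)) (trans (J-top b lo) mid) ⟩
    A b + A⁻ (suc b)      ≡⟨ cong (λ t → when t (A b + A⁻ (suc b))) (≤⇒≤ᵇ≡true (ℕₚ.≤-refl {b})) ⟨
    when (b ≤ᵇ b) (A b + A⁻ (suc b))
      ≡⟨ J-top b (λ c c<b → when-false (A c + A⁻ (suc c)) (>⇒≤ᵇ≡false c<b)) ⟨
    J x b (λ c → when (b ≤ᵇ c) (A c + A⁻ (suc c))) ∎
  J-telescope b Y A A⁻ lo mid hi (suc a) _ | inj₁ (s≤s b≤a) = begin
    (Y (suc a) + x * J x a Y) + A⁻ (suc (suc a))
      ≡⟨ cong (λ z → (z + x * J x a Y) + A⁻ (suc (suc a))) (hi (suc a) (s≤s b≤a)) ⟩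
    ((A (suc a) + x * A⁻ (suc a)) + x * J x a Y) + A⁻ (suc (suc a))
      ≡⟨ ring x (A (suc a)) (A⁻ (suc a)) (J x a Y) (A⁻ (suc (suc a))) ⟩
    (A (suc a) + A⁻ (suc (suc a))) + x * (J x a Y + A⁻ (suc a))
      ≡⟨ cong₂ (λ t z → when t (A (suc a) + A⁻ (suc (suc a))) + x * z)
               (sym (≤⇒≤ᵇ≡true (ℕₚ.m≤n⇒m≤1+n b≤a))) (J-telescope b Y A A⁻ lo mid hi a b≤a) ⟩
    when (b ≤ᵇ suc a) (A (suc a) + A⁻ (suc (suc a)))
      + x * J x a (λ c → when (b ≤ᵇ c) (A c + A⁻ (suc c))) ∎
    where
    ring : ∀ x A A' j B → ((A + x * A') + x * j) + B ≡ (A + B) + x * (j + A')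
    ring = solve-∀

  -- H F λ = Σ x^|λ/ν| F ν over the ν for which λ/ν is a horizontal strip; ν has as many rows as λ,
  -- possibly empty ones.
  H : (Shape → ℤ) → Shape → ℤ
  H F []       = F []
  H F (a ∷ λs) = J x a (λ c → when (hd λs ≤ᵇ c) (H (F ∘ (c ∷_)) λs))

  H-ext : ∀ λs {F G : Shape → ℤ} → (∀ μ → F μ ≡ G μ) → H F λs ≡ H G λs
  H-ext []       h = h []
  H-ext (a ∷ λs) h = J-cong a (λ c _ → cong (when (hd λs ≤ᵇ c)) (H-ext λs (h ∘ (c ∷_))))

  -- The guards let `H` see partitions only. An induction hypothesis that is known for partitions
  -- can therefore be used under `H`.
  H-cong : ∀ λs {F G : Shape → ℤ} → (∀ ν → IsPart ν → hd ν ≤ hd λs → F ν ≡ G ν) → H F λs ≡ H G λs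
  H-cong []       h = h [] tt z≤n
  H-cong (a ∷ λs) {F} {G} h = J-cong a step
    where
    step : ∀ c → c ≤ a → when (hd λs ≤ᵇ c) (H (F ∘ (c ∷_)) λs) ≡ when (hd λs ≤ᵇ c) (H (G ∘ (c ∷_)) λs)
    step c c≤a with hd λs ≤ᵇ c in eq
    ... | false = refl
    ... | true  = H-cong λs (λ ν pν hν → h (c ∷ ν) (ℕₚ.≤-trans hν (ℕₚ.≤ᵇ⇒≤ _ _ (subst T (sym eq) tt)) , pν) c≤a)

  H-+ : ∀ λs (F G : Shape → ℤ) → H (λ μ → F μ + G μ) λs ≡ H F λs + H G λs
  H-+ []       F G = refl
  H-+ (a ∷ λs) F G = trans
    (J-cong a (λ c _ → trans (cong (when (hd λs ≤ᵇ c)) (H-+ λs (F ∘ (c ∷_)) (G ∘ (c ∷_)))) (when-+ (hd λs ≤ᵇ c) _ _)))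
    (J-+ a _ _)

  H-* : ∀ λs k (F : Shape → ℤ) → H (λ μ → k * F μ) λs ≡ k * H F λs
  H-* []       k F = refl
  H-* (a ∷ λs) k F = trans
    (J-cong a (λ c _ → trans (cong (when (hd λs ≤ᵇ c)) (H-* λs k (F ∘ (c ∷_)))) (sym (when-* (hd λs ≤ᵇ c) k _))))
    (J-* a k _)

  H-0 : ∀ λs → H (λ _ → 0ℤ) λs ≡ 0ℤ
  H-0 λs = trans (H-* λs 0ℤ (λ _ → 0ℤ)) (*-zeroˡ (H (λ _ → 0ℤ) λs))

-- `V` also produces shapes that are not partitions; extension by zero makes them harmless.
Vanishing : (Shape → ℤ) → Set
Vanishing F = ∀ λs → ¬ IsPart λs → F λs ≡ 0ℤ

-- `H` may empty the last row but keeps it in the list, so shapes that differ by a trailing zero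
-- must have equal values.
Padded : (Shape → ℤ) → Set
Padded F = ∀ λs → F (λs ∷ʳ 0) ≡ F λs

module _ (x : ℤ) where

  -- A horizontal strip needs a length `c` between the second row and the first; if the second row
  -- is longer, the sum is empty, whatever `F` is.
  H-vanishing : ∀ F → Vanishing (H x F)
  H-vanishing F []       ¬p = ⊥-elim (¬p tt)
  H-vanishing F (a ∷ λs) ¬p = trans (J-cong x a step) (J-0 x a)
    where
    step : ∀ c → c ≤ a → when (hd λs ≤ᵇ c) (H x (F ∘ (c ∷_)) λs) ≡ 0ℤ
    step c c≤a with hd λs ≤ᵇ c in eq
    ... | false = refl
    ... | true  = H-vanishing _ λs (λ p → ¬p (ℕₚ.≤-trans (ℕₚ.≤ᵇ⇒≤ _ _ (subst T (sym eq) tt)) c≤a , p))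

  hd-pad : ∀ λs → hd (λs ∷ʳ 0) ≡ hd λs
  hd-pad []      = refl
  hd-pad (_ ∷ _) = refl

  H-padded : ∀ {F} → Padded F → Padded (H x F)
  H-padded z []       = z []
  H-padded z (a ∷ λs) = J-cong x a (λ c _ → cong₂ (λ t v → when (t ≤ᵇ c) v) (hd-pad λs) (H-padded (z ∘ (c ∷_)) λs))

  -- A horizontal strip takes at most the bottom box of a column, since every other row has a row of
  -- length 1 below it.
  H-column : ∀ k {F} → Padded F → H x F (replicate (suc k) 1) ≡ F (replicate (suc k) 1) + x * F (replicate k 1)
  H-column zero    {F} z = cong (λ v → F (1 ∷ []) + x * v) (z [])
  H-column (suc k) {F} z = begin
    H x F₁ (replicate (suc k) 1) + x * 0ℤ  ≡⟨ cong (H x F₁ (replicate (suc k) 1) +_) (*-zeroʳ x) ⟩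
    H x F₁ (replicate (suc k) 1) + 0ℤ      ≡⟨ +-identityʳ _ ⟩
    H x F₁ (replicate (suc k) 1)           ≡⟨ H-column k (z ∘ (1 ∷_)) ⟩
    F₁ (replicate (suc k) 1) + x * F₁ (replicate k 1) ∎
    where
    F₁ : Shape → ℤ
    F₁ = F ∘ (1 ∷_)

  -- This is the effect of one more variable, e_k becoming e_k + x e_{k-1}, seen on shapes: the
  -- second term removes one box more and adds one box fewer. The three mutual statements split the
  -- induction over rows.
  commute : ∀ k λs F → IsPart λs → Vanishing F → Padded F →
            V k (H x F) λs ≡ H x (V k F) λs + x * H x (V⁻ k F) λs
  -- Shortening the first row to `c` and then adding a strip gives a first row `c` or `c + 1`.
  -- Strips that leave the outer first row at `a` account for all of these except `c + 1 = a + 1`,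
  -- which the second summand supplies.
  commute-fixed : ∀ k a λs F → IsPart (a ∷ λs) → Vanishing F → Padded F →
            V k (H x F ∘ (a ∷_)) λs + H x (V⁻ k (F ∘ (suc a ∷_))) λs ≡ H x (V k F) (a ∷ λs)
  -- When the first row is cut down to the length of the second, a strip can no longer enlarge the
  -- second row. On the right such strips give shapes like `b ∷ suc b ∷ κ`, where `F` vanishes, so
  -- the term with factor `x` is absent.
  commute-bottom : ∀ k λs F → IsPart λs → Vanishing F → Padded F →
            V k (λ μ → when (hd μ ≤ᵇ hd λs) (H x (F ∘ (hd λs ∷_)) μ)) λs ≡ H x (V k (F ∘ (hd λs ∷_))) λs

  vanish-tail : ∀ {F} a → Vanishing F → Vanishing (F ∘ (a ∷_))
  vanish-tail a v λs ¬p = v (a ∷ λs) (¬p ∘ proj₂)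

  commute zero    [] F p v z = sym (trans (cong (F [] +_) (*-zeroʳ x)) (+-identityʳ _))
  commute (suc k) [] F p v z = H-column k z
  commute zero (a ∷ λs) F p v z = begin
    V 0 (H x F ∘ (a ∷_)) λs + 0ℤ
      ≡⟨ cong (V 0 (H x F ∘ (a ∷_)) λs +_) (sym (H-0 x λs)) ⟩
    V 0 (H x F ∘ (a ∷_)) λs + H x (V⁻ 0 (F ∘ (suc a ∷_))) λs
      ≡⟨ commute-fixed 0 a λs F p v z ⟩
    H x (V 0 F) (a ∷ λs)
      ≡⟨ sym (trans (cong (H x (V 0 F) (a ∷ λs) +_) (trans (cong (x *_) (H-0 x (a ∷ λs))) (*-zeroʳ x))) (+-identityʳ _)) ⟩
    H x (V 0 F) (a ∷ λs) + x * H x (V⁻ 0 F) (a ∷ λs) ∎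
  commute (suc k) (a ∷ λs) F p@(b≤a , pλ) v z = begin
    M (suc k) + V k (H x F ∘ (suc a ∷_)) λs
      -- From a first row of length `a + 1` either no box is removed, or one is removed and the
      -- removal goes on from length `a`. The guard holds since the strip raises the second row to
      -- at most `hd λs + 1`.
      ≡⟨ cong (M (suc k) +_) (V-cong k λs split) ⟩
    M (suc k) + V k (λ μ → H x F₊ μ + x * H x F (a ∷ μ)) λs
      ≡⟨ cong (M (suc k) +_) (trans (V-+ k λs (H x F₊) _) (cong (V k (H x F₊) λs +_) (V-* k λs x _))) ⟩
    M (suc k) + (V k (H x F₊) λs + x * M k)
      ≡⟨ cong (λ t → M (suc k) + (t + x * M k)) (commute k λs F₊ pλ (vanish-tail (suc a) v) (z ∘ (suc a ∷_))) ⟩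
    M (suc k) + ((H x (V k F₊) λs + x * H x (V⁻ k F₊) λs) + x * M k)
      ≡⟨ ring (M (suc k)) (H x (V k F₊) λs) x (H x (V⁻ k F₊) λs) (M k) ⟩
    (M (suc k) + H x (V k F₊) λs) + x * (M k + H x (V⁻ k F₊) λs)
      ≡⟨ cong₂ (λ s t → s + x * t) (commute-fixed (suc k) a λs F p v z) (commute-fixed k a λs F p v z) ⟩
    H x (V (suc k) F) (a ∷ λs) + x * H x (V k F) (a ∷ λs) ∎
    where
    F₊ : Shape → ℤ
    F₊ = F ∘ (suc a ∷_)
    M : ℕ → ℤ
    M k = V k (H x F ∘ (a ∷_)) λs
    split : ∀ μ → hd λs ≤ hd μ → hd μ ≤ suc (hd λs) → H x F (suc a ∷ μ) ≡ H x F₊ μ + x * H x F (a ∷ μ)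
    split μ _ h rewrite ≤⇒≤ᵇ≡true (ℕₚ.≤-trans h (s≤s b≤a)) = refl
    ring : ∀ m h x h' m' → m + ((h + x * h') + x * m') ≡ (m + h) + x * (m' + h')
    ring = solve-∀

  commute-fixed k a λs F (b≤a , pλ) v z = begin
    V k (λ μ → J x a (λ c → when (hd μ ≤ᵇ c) (H x (F ∘ (c ∷_)) μ))) λs + A⁻ (suc a)
      ≡⟨ cong (_+ A⁻ (suc a)) (J-V x a k λs (λ c μ → when (hd μ ≤ᵇ c) (H x (F ∘ (c ∷_)) μ))) ⟩
    J x a Y + A⁻ (suc a)
      ≡⟨ J-telescope x (hd λs) Y A A⁻ lo (commute-bottom k λs F pλ v z) hi a b≤a ⟩
    J x a (λ c → when (hd λs ≤ᵇ c) (A c + A⁻ (suc c)))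
      ≡⟨ J-cong x a (λ c _ → cong (when (hd λs ≤ᵇ c)) (sym (H-+ x λs (V k (F ∘ (c ∷_))) (V⁻ k (F ∘ (suc c ∷_)))))) ⟩
    H x (V k F) (a ∷ λs) ∎
    where
    Y A A⁻ : ℕ → ℤ
    Y  c = V k (λ μ → when (hd μ ≤ᵇ c) (H x (F ∘ (c ∷_)) μ)) λs
    A  c = H x (V k (F ∘ (c ∷_))) λs
    A⁻ c = H x (V⁻ k (F ∘ (c ∷_))) λs
    lo : ∀ c → c < hd λs → Y c ≡ 0ℤ
    lo c c<b = trans (V-cong k λs (λ μ b≤ _ → when-false _ (>⇒≤ᵇ≡false (ℕₚ.<-≤-trans c<b b≤)))) (V-0 k λs)
    hi : ∀ c → hd λs < c → Y c ≡ A c + x * A⁻ c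
    hi c b<c = trans (V-cong k λs (λ μ _ ≤b → when-true _ (≤⇒≤ᵇ≡true (ℕₚ.≤-trans ≤b b<c))))
                     (commute k λs (F ∘ (c ∷_)) pλ (vanish-tail c v) (z ∘ (c ∷_)))

  commute-bottom zero    [] F p v z = refl
  commute-bottom (suc k) [] F p v z = sym (v (0 ∷ replicate (suc k) 1) (λ ()))
  commute-bottom k (b ∷ λs) F p v z = begin
    V k (λ μ → when (b ≤ᵇ b) (H x F₌ (b ∷ μ))) λs + V⁻ k (λ μ → when (suc b ≤ᵇ b) (H x F₌ (suc b ∷ μ))) λs
      ≡⟨ cong₂ _+_ (V-ext k λs (λ μ → when-true _ (≤⇒≤ᵇ≡true (ℕₚ.≤-refl {b}))))
           (trans (V⁻-ext k λs (λ μ → when-false (H x F₌ (suc b ∷ μ)) (>⇒≤ᵇ≡false (ℕₚ.n<1+n b)))) (V⁻-0 k λs)) ⟩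
    V k (H x F₌ ∘ (b ∷_)) λs + 0ℤ
      ≡⟨ cong (V k (H x F₌ ∘ (b ∷_)) λs +_) (sym zero-term) ⟩
    V k (H x F₌ ∘ (b ∷_)) λs + H x (V⁻ k (F₌ ∘ (suc b ∷_))) λs
      ≡⟨ commute-fixed k b λs F₌ p (vanish-tail b v) (z ∘ (b ∷_)) ⟩
    H x (V k F₌) (b ∷ λs) ∎
    where
    F₌ : Shape → ℤ
    F₌ = F ∘ (b ∷_)
    zero-term : H x (V⁻ k (F₌ ∘ (suc b ∷_))) λs ≡ 0ℤ
    zero-term = trans (H-ext x λs (λ ν → trans (V⁻-ext k ν (λ κ → v (b ∷ suc b ∷ κ) (λ q → ℕₚ.<⇒≱ (ℕₚ.n<1+n b) (proj₁ q)))) (V⁻-0 k ν)))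
                      (H-0 x λs)

-- Schur functions by branching

e : (ℕ → ℤ) → ℕ → ℕ → ℤ
e x N       zero    = 1ℤ
e x zero    (suc k) = 0ℤ
e x (suc N) (suc k) = e x N (suc k) + x N * e x N k

-- In no variables s_λ is 1 for the empty partition and 0 otherwise. Zero rows count as empty
-- because `H` shortens rows without deleting them.
empty-shape : Shape → ℤ
empty-shape []          = 1ℤ
empty-shape (zero ∷ λs) = empty-shape λs
empty-shape (suc _ ∷ _) = 0ℤ

-- The branching rule serves as the definition, which suits induction on the variables; `rows-schur`
-- identifies it with the sum over tableaux.
schur : (ℕ → ℤ) → ℕ → Shape → ℤ
schur x zero    = empty-shape
schur x (suc N) = H (x N) (schur x N)

empty-vanishing : Vanishing empty-shape
empty-vanishing []           ¬p = ⊥-elim (¬p tt)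
empty-vanishing (suc _ ∷ λs) ¬p = refl
empty-vanishing (zero ∷ []) ¬p = ⊥-elim (¬p (z≤n , tt))
empty-vanishing (zero ∷ zero ∷ λs) ¬p = empty-vanishing (zero ∷ λs) (λ p → ¬p (z≤n , p))
empty-vanishing (zero ∷ suc _ ∷ λs) ¬p = refl

empty-padded : Padded empty-shape
empty-padded []           = refl
empty-padded (zero ∷ λs)  = empty-padded λs
empty-padded (suc _ ∷ λs) = refl

schur-vanishing : ∀ x N → Vanishing (schur x N)
schur-vanishing x zero    = empty-vanishing
schur-vanishing x (suc N) = H-vanishing (x N) (schur x N)

schur-padded : ∀ x N → Padded (schur x N)
schur-padded x zero    = empty-padded
schur-padded x (suc N) = H-padded (x N) (schur-padded x N)

V-zero : ∀ λs F → V 0 F λs ≡ F λs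
V-zero []       F = refl
V-zero (a ∷ λs) F = trans (+-identityʳ _) (V-zero λs (F ∘ (a ∷_)))

V-empty : ∀ k λs → V (suc k) empty-shape λs ≡ 0ℤ
V-empty k []           = refl
V-empty k (zero ∷ λs)  = cong₂ _+_ (V-empty k λs) (V-0 k λs)
V-empty k (suc a ∷ λs) = cong₂ _+_ (V-0 (suc k) λs) (V-0 k λs)

-- Both factors are expanded in the last variable. The induction hypothesis is applied under `H` to
-- the smaller shapes, and `commute` reassembles the two terms.
pieri : ∀ x N k λs → IsPart λs → e x N k * schur x N λs ≡ V k (schur x N) λs
pieri x N       zero    λs p = trans (*-identityˡ _) (sym (V-zero λs _))
pieri x zero    (suc k) λs p = sym (V-empty k λs)
pieri x (suc N) (suc k) λs p = begin
  (e x N (suc k) + x N * e x N k) * H (x N) S λs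
    ≡⟨ ring (e x N (suc k)) (x N) (e x N k) (H (x N) S λs) ⟩
  e x N (suc k) * H (x N) S λs + x N * (e x N k * H (x N) S λs)
    ≡⟨ cong₂ (λ s t → s + x N * t) (pull (suc k)) (pull k) ⟩
  H (x N) (V (suc k) S) λs + x N * H (x N) (V k S) λs
    ≡⟨ commute (x N) (suc k) λs S p (schur-vanishing x N) (schur-padded x N) ⟨
  V (suc k) (H (x N) S) λs ∎
  where
  S : Shape → ℤ
  S = schur x N
  pull : ∀ k → e x N k * H (x N) S λs ≡ H (x N) (V k S) λs
  pull k = trans (sym (H-* (x N) λs (e x N k) S)) (H-cong (x N) λs (λ ν pν _ → pieri x N k ν pν))
  ring : ∀ a x b h → (a + x * b) * h ≡ a * h + x * (b * h)
  ring = solve-∀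

-- Semistandard tableaux

mon : (ℕ → ℤ) → List ℕ → ℤ
mon x []      = 1ℤ
mon x (c ∷ w) = x c * mon x w

mon-++ : ∀ x u v → mon x (u ++ v) ≡ mon x u * mon x v
mon-++ x []      v = sym (*-identityˡ _)
mon-++ x (c ∷ u) v = trans (cong (x c *_) (mon-++ x u v)) (sym (*-assoc (x c) (mon x u) (mon x v)))

∑-words-suc : ∀ N n (f : List ℕ → ℤ) → ∑ (words N (suc n)) f ≡ ∑< N (λ c → ∑ (words N n) (f ∘ (c ∷_)))
∑-words-suc N n f = begin
  ∑ (words N (suc n)) f
    ≡⟨ ∑-concatMap (λ c → map (c ∷_) (words N n)) (upTo N) f ⟩
  ∑ (upTo N) (λ c → ∑ (map (c ∷_) (words N n)) f)
    ≡⟨ ∑-upTo N _ ⟩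
  ∑< N (λ c → ∑ (map (c ∷_) (words N n)) f)
    ≡⟨ ∑<-cong N (λ c _ → ∑-map (c ∷_) (words N n) f) ⟩
  ∑< N (λ c → ∑ (words N n) (f ∘ (c ∷_))) ∎

asc : ℕ → List ℕ → Bool
asc d []      = true
asc d (c ∷ w) = (d ≤ᵇ c) ∧ asc c w

weaklyDecr-ʳ++ : ∀ w d acc → weaklyDecr (w ʳ++ (d ∷ acc)) ≡ asc d w ∧ weaklyDecr (d ∷ acc)
weaklyDecr-ʳ++ []      d acc = refl
weaklyDecr-ʳ++ (c ∷ w) d acc = begin
  weaklyDecr (w ʳ++ (c ∷ d ∷ acc))                   ≡⟨ weaklyDecr-ʳ++ w c (d ∷ acc) ⟩
  asc c w ∧ ((d ≤ᵇ c) ∧ weaklyDecr (d ∷ acc))        ≡⟨ ∧-assoc (asc c w) (d ≤ᵇ c) _ ⟨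
  (asc c w ∧ (d ≤ᵇ c)) ∧ weaklyDecr (d ∷ acc)        ≡⟨ cong (_∧ weaklyDecr (d ∷ acc)) (∧-comm (asc c w) (d ≤ᵇ c)) ⟩
  ((d ≤ᵇ c) ∧ asc c w) ∧ weaklyDecr (d ∷ acc)        ∎

weaklyDecr-reverse : ∀ w → weaklyDecr (reverse w) ≡ asc 0 w
weaklyDecr-reverse []      = refl
weaklyDecr-reverse (c ∷ w) = trans (weaklyDecr-ʳ++ w c []) (∧-identityʳ _)

-- W x N d a G = Σ x^w G(w) over the weakly increasing words w of length a with letters in [d, N).
W : (ℕ → ℤ) → ℕ → ℕ → ℕ → (List ℕ → ℤ) → ℤ
W x N d zero    G = G []
W x N d (suc a) G = ∑< N (λ c → when (d ≤ᵇ c) (x c * W x N c a (G ∘ (c ∷_))))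

∑-asc : ∀ x N d a G → ∑ (words N a) (λ w → when (asc d w) (mon x w * G w)) ≡ W x N d a G
∑-asc x N d zero    G = trans (+-identityʳ _) (*-identityˡ _)
∑-asc x N d (suc a) G = trans (∑-words-suc N a _) (∑<-cong N (λ c _ → step c))
  where
  step : ∀ c → ∑ (words N a) (λ w → when ((d ≤ᵇ c) ∧ asc c w) (x c * mon x w * G (c ∷ w)))
             ≡ when (d ≤ᵇ c) (x c * W x N c a (G ∘ (c ∷_)))
  step c with d ≤ᵇ c
  ... | false = ∑-0 (words N a)
  ... | true  = begin
    ∑ (words N a) (λ w → when (asc c w) (x c * mon x w * G (c ∷ w)))
      ≡⟨ ∑-cong (words N a) (λ w → trans (cong (when (asc c w)) (*-assoc (x c) (mon x w) (G (c ∷ w))))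
                                         (sym (when-* (asc c w) (x c) _))) ⟩
    ∑ (words N a) (λ w → x c * when (asc c w) (mon x w * G (c ∷ w)))
      ≡⟨ ∑-* (words N a) (x c) _ ⟩
    x c * ∑ (words N a) (λ w → when (asc c w) (mon x w * G (c ∷ w)))
      ≡⟨ cong (x c *_) (∑-asc x N c a (G ∘ (c ∷_))) ⟩
    x c * W x N c a (G ∘ (c ∷_)) ∎

when-cong : ∀ b {u v} → u ≡ v → when b u ≡ when b v
when-cong b refl = refl

when-0 : ∀ b → when b 0ℤ ≡ 0ℤ
when-0 true  = refl
when-0 false = refl

when-swap : ∀ p q v → when p (when q v) ≡ when q (when p v)
when-swap true  q v = refl
when-swap false q v = sym (when-0 q)

W-cong : ∀ x N d a {G G' : List ℕ → ℤ} → (∀ w → length w ≡ a → All (_< N) w → G w ≡ G' w) →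
         W x N d a G ≡ W x N d a G'
W-cong x N d zero    h = h [] refl []
W-cong x N d (suc a) h = ∑<-cong N (λ c c<N → when-cong (d ≤ᵇ c)
  (cong (x c *_) (W-cong x N c a (λ w lw aw → h (c ∷ w) (cong suc lw) (c<N ∷ aw)))))

W-0 : ∀ x N d a → W x N d a (λ _ → 0ℤ) ≡ 0ℤ
W-0 x N d zero    = refl
W-0 x N d (suc a) = trans
  (∑<-cong N (λ c _ → trans (when-cong (d ≤ᵇ c) (trans (cong (x c *_) (W-0 x N c a)) (*-zeroʳ (x c)))) (when-0 (d ≤ᵇ c))))
  (∑<-0 N)

W-when : ∀ x N d a b G → W x N d a (λ w → when b (G w)) ≡ when b (W x N d a G)
W-when x N d a true  G = refl
W-when x N d a false G = W-0 x N d a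

J-when : ∀ y h b f → J y h (λ c → when b (f c)) ≡ when b (J y h f)
J-when y h true  f = refl
J-when y h false f = J-0 y h

J-∑< : ∀ y h N (g : ℕ → ℕ → ℤ) → J y h (λ j → ∑< N (λ c → g c j)) ≡ ∑< N (λ c → J y h (g c))
J-∑< y h zero    g = J-0 y h
J-∑< y h (suc N) g = trans (J-+ y h _ (g N)) (cong (_+ J y h (g N)) (J-∑< y h N g))

-- `f'` lives at index 0 only, so `J y h f'` is y^h `f 0`, and a further factor `y` makes it the
-- lowest term of the longer sum.
J-shift : ∀ y h (f f' : ℕ → ℤ) → f' 0 ≡ f 0 → (∀ j → f' (suc j) ≡ 0ℤ) →
          J y (suc h) f ≡ J y h (f ∘ suc) + y * J y h f'
J-shift y zero    f f' h0 hs = cong (λ v → f 1 + y * v) (sym h0)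
J-shift y (suc h) f f' h0 hs = begin
  f (suc (suc h)) + y * J y (suc h) f
    ≡⟨ cong (λ v → f (suc (suc h)) + y * v) (J-shift y h f f' h0 hs) ⟩
  f (suc (suc h)) + y * (J y h (f ∘ suc) + y * J y h f')
    ≡⟨ ring (f (suc (suc h))) y (J y h (f ∘ suc)) (J y h f') ⟩
  (f (suc (suc h)) + y * J y h (f ∘ suc)) + y * (0ℤ + y * J y h f')
    ≡⟨ cong (λ v → (f (suc (suc h)) + y * J y h (f ∘ suc)) + y * (v + y * J y h f')) (sym (hs h)) ⟩
  (f (suc (suc h)) + y * J y h (f ∘ suc)) + y * (f' (suc h) + y * J y h f') ∎
  where
  ring : ∀ a y b c → a + y * (b + y * c) ≡ (a + y * b) + y * (0ℤ + y * c)
  ring = solve-∀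

W-top : ∀ x N a G → W x N N (suc a) G ≡ 0ℤ
W-top x N a G = trans (∑<-cong N (λ c c<N → when-false _ (>⇒≤ᵇ≡false c<N))) (∑<-0 N)

fill : ℕ → ℕ → List ℕ → List ℕ
fill N a w = w ++ replicate (a ∸ length w) N

-- In a weakly increasing word the letters `N` form a final block; `j` counts the letters before it,
-- and the power of `x N` is the length of the block.
W-branch : ∀ x N d a G → d ≤ N → W x (suc N) d a G ≡ J (x N) a (λ j → W x N d j (G ∘ fill N a))
W-branch x N d zero    G d≤N = refl
W-branch x N d (suc a) G d≤N = begin
  ∑< N (λ c → when (d ≤ᵇ c) (x c * W x (suc N) c a (G ∘ (c ∷_))))
    + when (d ≤ᵇ N) (x N * W x (suc N) N a (G ∘ (N ∷_)))
    ≡⟨ cong₂ _+_ (∑<-cong N (λ c c<N → smaller c (ℕₚ.<⇒≤ c<N)))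
                 (trans (when-true _ (≤⇒≤ᵇ≡true d≤N)) (cong (x N *_) (W-branch x N N a (G ∘ (N ∷_)) ℕₚ.≤-refl))) ⟩
  ∑< N (λ c → J (x N) a (λ j → when (d ≤ᵇ c) (x c * W x N c j (G ∘ fill N (suc a) ∘ (c ∷_)))))
    + x N * J (x N) a (λ j → W x N N j (G ∘ (N ∷_) ∘ fill N a))
    ≡⟨ cong (_+ x N * J (x N) a (λ j → W x N N j (G ∘ (N ∷_) ∘ fill N a))) (J-∑< (x N) a N _) ⟨
  J (x N) a (λ j → W x N d (suc j) (G ∘ fill N (suc a)))
    + x N * J (x N) a (λ j → W x N N j (G ∘ (N ∷_) ∘ fill N a))
    -- After a first letter `N` only letters `N` can follow, so the second sum lives at `j = 0`.
    ≡⟨ J-shift (x N) a (λ j → W x N d j (G ∘ fill N (suc a))) _ refl (λ j → W-top x N j (G ∘ (N ∷_) ∘ fill N a)) ⟨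
  J (x N) (suc a) (λ j → W x N d j (G ∘ fill N (suc a))) ∎
  where
  smaller : ∀ c → c ≤ N → when (d ≤ᵇ c) (x c * W x (suc N) c a (G ∘ (c ∷_)))
          ≡ J (x N) a (λ j → when (d ≤ᵇ c) (x c * W x N c j (G ∘ fill N (suc a) ∘ (c ∷_))))
  smaller c c≤N = begin
    when (d ≤ᵇ c) (x c * W x (suc N) c a (G ∘ (c ∷_)))
      ≡⟨ when-cong (d ≤ᵇ c) (cong (x c *_) (W-branch x N c a (G ∘ (c ∷_)) c≤N)) ⟩
    when (d ≤ᵇ c) (x c * J (x N) a (λ j → W x N c j (G ∘ fill N (suc a) ∘ (c ∷_))))
      ≡⟨ when-cong (d ≤ᵇ c) (J-* (x N) a (x c) _) ⟨
    when (d ≤ᵇ c) (J (x N) a (λ j → x c * W x N c j (G ∘ fill N (suc a) ∘ (c ∷_))))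
      ≡⟨ J-when (x N) a (d ≤ᵇ c) _ ⟨
    J (x N) a (λ j → when (d ≤ᵇ c) (x c * W x N c j (G ∘ fill N (suc a) ∘ (c ∷_)))) ∎

H-when : ∀ y λs b F → H y (λ ν → when b (F ν)) λs ≡ when b (H y F λs)
H-when y λs true  F = refl
H-when y λs false F = H-0 y λs

H-∑< : ∀ y λs N (F : ℕ → Shape → ℤ) → H y (λ ν → ∑< N (λ c → F c ν)) λs ≡ ∑< N (λ c → H y (F c) λs)
H-∑< y λs zero    F = H-0 y λs
H-∑< y λs (suc N) F = trans (H-+ y λs _ (F N)) (cong (_+ H y (F N) λs) (H-∑< y λs N F))

H-W : ∀ y λs x N d a (F : List ℕ → Shape → ℤ) →
      H y (λ ν → W x N d a (λ w → F w ν)) λs ≡ W x N d a (λ w → H y (F w) λs)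
H-W y λs x N d zero    F = refl
H-W y λs x N d (suc a) F = trans (H-∑< y λs N _) (∑<-cong N (λ c _ →
  trans (H-when y λs (d ≤ᵇ c) _) (when-cong (d ≤ᵇ c)
    (trans (H-* y λs (x c) _) (cong (x c *_) (H-W y λs x N c a (F ∘ (c ∷_))))))))

<ᵇ-true : ∀ {m n} → m < n → (m <ᵇ n) ≡ true
<ᵇ-true = ≤⇒≤ᵇ≡true

<ᵇ-irrefl : ∀ n → (n <ᵇ n) ≡ false
<ᵇ-irrefl n = >⇒≤ᵇ≡false (ℕₚ.n<1+n n)

≤ᵇ-suc : ∀ m n → (suc m ≤ᵇ suc n) ≡ (m ≤ᵇ n)
≤ᵇ-suc zero    n = refl
≤ᵇ-suc (suc m) n = refl

∧-left-comm : ∀ a b c → a ∧ (b ∧ c) ≡ b ∧ (a ∧ c)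
∧-left-comm true  true  c = refl
∧-left-comm true  false c = refl
∧-left-comm false true  c = refl
∧-left-comm false false c = refl

-- Nothing can stand below the maximal letter `N`, so the whole lower row, of length `b`, must fit
-- under `u`: this is the horizontal strip condition. A letter `N` below a smaller letter is always
-- allowed, which leaves the comparison of `u` with `w`.
colStrict-fill : ∀ N j b u w → All (_< N) u → All (_< N) w → length w ≤ b →
  colStrict (u ++ replicate j N) (fill N b w) ≡ (b ≤ᵇ length u) ∧ colStrict u w
colStrict-fill N j zero    u       []      au aw _ = refl
colStrict-fill N zero    (suc b) [] []      au aw _ = refl
colStrict-fill N (suc j) (suc b) [] []      au aw _ = cong (_∧ colStrict (replicate j N) (replicate b N)) (<ᵇ-irrefl N)
colStrict-fill N zero    (suc b) [] (z ∷ w) au aw _ = refl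
colStrict-fill N (suc j) (suc b) [] (z ∷ w) au (z<N ∷ aw) _ =
  cong (_∧ colStrict (replicate j N) (fill N b w)) (>⇒≤ᵇ≡false (ℕₚ.m<n⇒m<1+n z<N))
colStrict-fill N j (suc b) (y ∷ u) [] (y<N ∷ au) aw _ = begin
  (y <ᵇ N) ∧ colStrict (u ++ replicate j N) (replicate b N)
    ≡⟨ cong₂ _∧_ (<ᵇ-true y<N) (colStrict-fill N j b u [] au [] z≤n) ⟩
  (b ≤ᵇ length u) ∧ true
    ≡⟨ cong (_∧ true) (≤ᵇ-suc b (length u)) ⟨
  (suc b ≤ᵇ suc (length u)) ∧ true ∎
colStrict-fill N j (suc b) (y ∷ u) (z ∷ w) (_ ∷ au) (_ ∷ aw) (s≤s l) = begin
  (y <ᵇ z) ∧ colStrict (u ++ replicate j N) (fill N b w)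
    ≡⟨ cong ((y <ᵇ z) ∧_) (colStrict-fill N j b u w au aw l) ⟩
  (y <ᵇ z) ∧ ((b ≤ᵇ length u) ∧ colStrict u w)
    ≡⟨ ∧-left-comm (y <ᵇ z) (b ≤ᵇ length u) _ ⟩
  (b ≤ᵇ length u) ∧ ((y <ᵇ z) ∧ colStrict u w)
    ≡⟨ cong (_∧ ((y <ᵇ z) ∧ colStrict u w)) (≤ᵇ-suc b (length u)) ⟨
  (suc b ≤ᵇ suc (length u)) ∧ ((y <ᵇ z) ∧ colStrict u w) ∎

-- The generating function of semistandard tableaux whose first row (the empty row if there is none)
-- satisfies g.
rows : (ℕ → ℤ) → ℕ → (List ℕ → Bool) → Shape → ℤ
rows x N g []       = when (g []) 1ℤ
rows x N g (a ∷ λs) = W x N 0 a (λ w → when (g w) (rows x N (colStrict w) λs))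

-- Deleting the letters N from a tableau leaves a tableau on fewer letters whose shape differs
-- from the original one by a horizontal strip.
rows-branch : ∀ x N λs g g' t →
  (∀ w → All (_< N) w → length w ≤ hd λs → g (fill N (hd λs) w) ≡ t ∧ g' w) →
  rows x (suc N) g λs ≡ when t (H (x N) (rows x N g') λs)
rows-branch x N []       g g' t h = trans (cong (λ b → when b 1ℤ) (h [] [] z≤n)) (when-∧ t (g' []) 1ℤ)
rows-branch x N (b ∷ λs) g g' t h = begin
  W x (suc N) 0 b (λ w → when (g w) (rows x (suc N) (colStrict w) λs))
    ≡⟨ W-branch x N 0 b _ z≤n ⟩
  J (x N) b (λ c → W x N 0 c (λ w → when (g (fill N b w)) (rows x (suc N) (colStrict (fill N b w)) λs)))
    ≡⟨ J-cong (x N) b per-row ⟩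
  J (x N) b (λ c → when t (when (hd λs ≤ᵇ c) (H (x N) (rows x N g' ∘ (c ∷_)) λs)))
    ≡⟨ J-when (x N) b t _ ⟩
  when t (H (x N) (rows x N g') (b ∷ λs)) ∎
  where
  per-word : ∀ c → c ≤ b → ∀ w → length w ≡ c → All (_< N) w →
    when (g (fill N b w)) (rows x (suc N) (colStrict (fill N b w)) λs)
    ≡ when t (when (hd λs ≤ᵇ c) (H (x N) (λ ν → when (g' w) (rows x N (colStrict w) ν)) λs))
  per-word c c≤b w refl aw = begin
    when (g (fill N b w)) (rows x (suc N) (colStrict (fill N b w)) λs)
      ≡⟨ cong₂ when (h w aw c≤b)
           -- The flag passed down is the strip condition: the next row may not be longer than what
           -- remains of this row without the letters `N`.
           (rows-branch x N λs (colStrict (fill N b w)) (colStrict w) (hd λs ≤ᵇ c)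
             (λ v av lv → colStrict-fill N (b ∸ length w) (hd λs) w v aw av lv)) ⟩
    when (t ∧ g' w) (when (hd λs ≤ᵇ c) R)
      ≡⟨ trans (when-∧ t (g' w) _) (when-cong t (when-swap (g' w) (hd λs ≤ᵇ c) R)) ⟩
    when t (when (hd λs ≤ᵇ c) (when (g' w) R))
      ≡⟨ when-cong t (when-cong (hd λs ≤ᵇ c) (sym (H-when (x N) λs (g' w) _))) ⟩
    when t (when (hd λs ≤ᵇ c) (H (x N) (λ ν → when (g' w) (rows x N (colStrict w) ν)) λs)) ∎
    where
    R : ℤ
    R = H (x N) (rows x N (colStrict w)) λs
  per-row : ∀ c → c ≤ b →
    W x N 0 c (λ w → when (g (fill N b w)) (rows x (suc N) (colStrict (fill N b w)) λs))
    ≡ when t (when (hd λs ≤ᵇ c) (H (x N) (rows x N g' ∘ (c ∷_)) λs))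
  per-row c c≤b = begin
    W x N 0 c (λ w → when (g (fill N b w)) (rows x (suc N) (colStrict (fill N b w)) λs))
      ≡⟨ W-cong x N 0 c (per-word c c≤b) ⟩
    W x N 0 c (λ w → when t (when (hd λs ≤ᵇ c) (H (x N) (λ ν → when (g' w) (rows x N (colStrict w) ν)) λs)))
      ≡⟨ trans (W-when x N 0 c t _) (when-cong t (W-when x N 0 c (hd λs ≤ᵇ c) _)) ⟩
    when t (when (hd λs ≤ᵇ c) (W x N 0 c (λ w → H (x N) (λ ν → when (g' w) (rows x N (colStrict w) ν)) λs)))
      ≡⟨ when-cong t (when-cong (hd λs ≤ᵇ c) (H-W (x N) λs x N 0 c (λ w ν → when (g' w) (rows x N (colStrict w) ν)))) ⟨
    when t (when (hd λs ≤ᵇ c) (H (x N) (rows x N g' ∘ (c ∷_)) λs)) ∎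

rows-empty : ∀ x λs g → g [] ≡ true → rows x 0 g λs ≡ empty-shape λs
rows-empty x []           g h = when-true _ h
rows-empty x (zero ∷ λs)  g h = trans (when-true _ h) (rows-empty x λs (colStrict []) refl)
rows-empty x (suc a ∷ λs) g h = refl

rows-schur : ∀ x N λs → rows x N (const true) λs ≡ schur x N λs
rows-schur x zero    λs = rows-empty x λs (const true) refl
rows-schur x (suc N) λs = trans (rows-branch x N λs (const true) (const true) true (λ _ _ _ → refl))
                                (H-ext (x N) λs (rows-schur x N))

-- Turning the condition imposed by the row above into the parameter `g` makes semistandardness
-- recursive in the rows, in step with `rows`.
tableau : (List ℕ → Bool) → List (List ℕ) → Bool
tableau g []      = g []
tableau g (r ∷ t) = asc 0 r ∧ (g r ∧ tableau (colStrict r) t)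

semistandard-tableau : ∀ t → semistandard t ≡ tableau (const true) t
semistandard-tableau []           = refl
semistandard-tableau (r ∷ [])     = trans (weaklyDecr-reverse r) (sym (∧-identityʳ _))
semistandard-tableau (r ∷ r' ∷ t) = cong₂ _∧_ (weaklyDecr-reverse r)
  (trans (cong (colStrict r r' ∧_) (semistandard-tableau (r' ∷ t))) (∧-left-comm (colStrict r r') (asc 0 r') _))

∑-tableau : ∀ x N λs g → ∑ (fillings N λs) (λ t → when (tableau g t) (mon x (concat t))) ≡ rows x N g λs
∑-tableau x N []       g = +-identityʳ _
∑-tableau x N (a ∷ λs) g = begin
  ∑ (fillings N (a ∷ λs)) (λ t → when (tableau g t) (mon x (concat t)))
    ≡⟨ ∑-concatMap (λ r → map (r ∷_) (fillings N λs)) (words N a) _ ⟩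
  ∑ (words N a) (λ r → ∑ (map (r ∷_) (fillings N λs)) (λ t → when (tableau g t) (mon x (concat t))))
    ≡⟨ ∑-cong (words N a) (λ r → trans (∑-map (r ∷_) (fillings N λs) _) (per-row r)) ⟩
  ∑ (words N a) (λ r → when (asc 0 r) (mon x r * when (g r) (rows x N (colStrict r) λs)))
    ≡⟨ ∑-asc x N 0 a _ ⟩
  W x N 0 a (λ r → when (g r) (rows x N (colStrict r) λs)) ∎
  where
  per-row : ∀ r → ∑ (fillings N λs) (λ t → when (asc 0 r ∧ (g r ∧ tableau (colStrict r) t)) (mon x (r ++ concat t)))
          ≡ when (asc 0 r) (mon x r * when (g r) (rows x N (colStrict r) λs))
  per-row r = begin
    ∑ (fillings N λs) (λ t → when (asc 0 r ∧ (g r ∧ tableau (colStrict r) t)) (mon x (r ++ concat t)))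
      ≡⟨ ∑-cong (fillings N λs) (λ t → begin
           when (asc 0 r ∧ (g r ∧ tableau (colStrict r) t)) (mon x (r ++ concat t))
             ≡⟨ trans (when-∧ (asc 0 r) _ _) (when-cong (asc 0 r) (when-∧ (g r) _ _)) ⟩
           when (asc 0 r) (when (g r) (when (tableau (colStrict r) t) (mon x (r ++ concat t))))
             ≡⟨ when-cong (asc 0 r) (when-cong (g r) (trans
                  (when-cong (tableau (colStrict r) t) (mon-++ x r (concat t)))
                  (sym (when-* (tableau (colStrict r) t) (mon x r) _)))) ⟩
           when (asc 0 r) (when (g r) (mon x r * when (tableau (colStrict r) t) (mon x (concat t)))) ∎) ⟩
    ∑ (fillings N λs) (λ t → when (asc 0 r) (when (g r) (mon x r * when (tableau (colStrict r) t) (mon x (concat t)))))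
      ≡⟨ trans (∑-when (fillings N λs) (asc 0 r) _) (when-cong (asc 0 r) (∑-when (fillings N λs) (g r) _)) ⟩
    when (asc 0 r) (when (g r) (∑ (fillings N λs) (λ t → mon x r * when (tableau (colStrict r) t) (mon x (concat t)))))
      ≡⟨ when-cong (asc 0 r) (when-cong (g r) (trans (∑-* (fillings N λs) (mon x r) _)
           (cong (mon x r *_) (∑-tableau x N λs (colStrict r))))) ⟩
    when (asc 0 r) (when (g r) (mon x r * rows x N (colStrict r) λs))
      ≡⟨ when-cong (asc 0 r) (sym (when-* (g r) (mon x r) _)) ⟩
    when (asc 0 r) (mon x r * when (g r) (rows x N (colStrict r) λs)) ∎

∑-semistandard : ∀ x N λs → ∑ (filterᵇ semistandard (fillings N λs)) (mon x ∘ concat) ≡ schur x N λs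
∑-semistandard x N λs = begin
  ∑ (filterᵇ semistandard (fillings N λs)) (mon x ∘ concat)
    ≡⟨ ∑-filter semistandard (fillings N λs) _ ⟩
  ∑ (fillings N λs) (λ t → when (semistandard t) (mon x (concat t)))
    ≡⟨ ∑-cong (fillings N λs) (λ t → cong (λ b → when b (mon x (concat t))) (semistandard-tableau t)) ⟩
  ∑ (fillings N λs) (λ t → when (tableau (const true) t) (mon x (concat t)))
    ≡⟨ trans (∑-tableau x N λs (const true)) (rows-schur x N λs) ⟩
  schur x N λs ∎

-- Paths and spiders

conv : (ℕ → ℤ) → (ℕ → ℤ) → ℕ → ℤ
conv f g zero    = f 0 * g 0
conv f g (suc n) = f 0 * g (suc n) + conv (f ∘ suc) g n

conv-last : ∀ f g n → conv f g (suc n) ≡ conv f (g ∘ suc) n + f (suc n) * g 0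
conv-last f g zero    = refl
conv-last f g (suc n) = trans (cong (f 0 * g (suc (suc n)) +_) (conv-last (f ∘ suc) g n)) (sym (+-assoc (f 0 * g (suc (suc n))) _ _))

conv-cong : ∀ {f f' g g' : ℕ → ℤ} → (∀ k → f k ≡ f' k) → (∀ k → g k ≡ g' k) → ∀ n → conv f g n ≡ conv f' g' n
conv-cong hf hg zero    = cong₂ _*_ (hf 0) (hg 0)
conv-cong hf hg (suc n) = cong₂ _+_ (cong₂ _*_ (hf 0) (hg (suc n))) (conv-cong (hf ∘ suc) hg n)

conv-linearˡ : ∀ f g y h n → conv (λ k → f k + y * g k) h n ≡ conv f h n + y * conv g h n
conv-linearˡ f g y h zero    = ring (f 0) y (g 0) (h 0)
  where
  ring : ∀ a y b c → (a + y * b) * c ≡ a * c + y * (b * c)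
  ring = solve-∀
conv-linearˡ f g y h (suc n) = trans
  (cong ((f 0 + y * g 0) * h (suc n) +_) (conv-linearˡ (f ∘ suc) (g ∘ suc) y h n))
  (ring (f 0) y (g 0) (h (suc n)) (conv (f ∘ suc) h n) (conv (g ∘ suc) h n))
  where
  ring : ∀ a y b c u v → (a + y * b) * c + (u + y * v) ≡ (a * c + u) + y * (b * c + v)
  ring = solve-∀

conv-linearʳ : ∀ h f g y n → conv h (λ k → f k + y * g k) n ≡ conv h f n + y * conv h g n
conv-linearʳ h f g y zero    = ring (f 0) y (g 0) (h 0)
  where
  ring : ∀ a y b c → c * (a + y * b) ≡ c * a + y * (c * b)
  ring = solve-∀
conv-linearʳ h f g y (suc n) = trans
  (cong (h 0 * (f (suc n) + y * g (suc n)) +_) (conv-linearʳ (h ∘ suc) f g y n))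
  (ring (f (suc n)) y (g (suc n)) (h 0) (conv (h ∘ suc) f n) (conv (h ∘ suc) g n))
  where
  ring : ∀ a y b c u v → c * (a + y * b) + (u + y * v) ≡ (c * a + u) + y * (c * b + v)
  ring = solve-∀

conv-*ʳ : ∀ f g y n → conv f (λ k → y * g k) n ≡ y * conv f g n
conv-*ʳ f g y zero    = *-left-comm (f 0) y (g 0)
conv-*ʳ f g y (suc n) = trans (cong₂ _+_ (*-left-comm (f 0) y (g (suc n))) (conv-*ʳ (f ∘ suc) g y n))
                              (sym (*-distribˡ-+ y (f 0 * g (suc n)) (conv (f ∘ suc) g n)))

conv-∑ʳ : ∀ N f (g : ℕ → ℕ → ℤ) n → conv f (λ k → ∑< N (g k)) n ≡ ∑< N (λ c → conv f (λ k → g k c) n)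
conv-∑ʳ N f g zero    = sym (∑<-* N (f 0) (g 0))
conv-∑ʳ N f g (suc n) = trans (cong₂ _+_ (sym (∑<-* N (f 0) (g (suc n)))) (conv-∑ʳ N (f ∘ suc) g n))
                              (sym (∑<-+ N _ _))

conv-∑ˡ : ∀ N (f : ℕ → ℕ → ℤ) g n → ∑< N (λ c → conv (λ k → f k c) g n) ≡ conv (λ k → ∑< N (f k)) g n
conv-∑ˡ N f g zero    = trans (∑<-cong N (λ c _ → *-comm (f 0 c) (g 0))) (trans (∑<-* N (g 0) (f 0)) (*-comm (g 0) _))
conv-∑ˡ N f g (suc n) = trans (∑<-+ N _ _) (cong₂ _+_
  (trans (∑<-cong N (λ c _ → *-comm (f 0 c) (g (suc n)))) (trans (∑<-* N (g (suc n)) (f 0)) (*-comm (g (suc n)) _)))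
  (conv-∑ˡ N (f ∘ suc) g n))

≡ᵇ-refl : ∀ n → (n ≡ᵇ n) ≡ true
≡ᵇ-refl zero    = refl
≡ᵇ-refl (suc n) = ≡ᵇ-refl n

<⇒≡ᵇ-false : ∀ {m n} → m < n → (m ≡ᵇ n) ≡ false
<⇒≡ᵇ-false {zero}  {suc n} _       = refl
<⇒≡ᵇ-false {suc m} {suc n} (s≤s l) = <⇒≡ᵇ-false l

>⇒≡ᵇ-false : ∀ {m n} → n < m → (m ≡ᵇ n) ≡ false
>⇒≡ᵇ-false {suc m} {zero}  _       = refl
>⇒≡ᵇ-false {suc m} {suc n} (s≤s l) = >⇒≡ᵇ-false l

∑<-exclude : ∀ N c (f : ℕ → ℤ) → c < N → ∑< N (λ d → when (not (c ≡ᵇ d)) (f d)) ≡ ∑< N f - f c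
∑<-exclude (suc N) c f (s≤s c≤N) with ℕₚ.m≤n⇒m<n∨m≡n c≤N
... | inj₁ c<N = trans
  (cong₂ _+_ (∑<-exclude N c f c<N) (when-true (f N) (cong not (<⇒≡ᵇ-false c<N))))
  (ring (∑< N f) (f c) (f N))
  where
  ring : ∀ s a b → (s - a) + b ≡ (s + b) - a
  ring = solve-∀
... | inj₂ refl = trans
  (cong₂ _+_ (∑<-cong N (λ d d<N → when-true (f d) (cong not (>⇒≡ᵇ-false d<N)))) (when-false (f N) (cong not (≡ᵇ-refl N))))
  (ring (∑< N f) (f N))
  where
  ring : ∀ s a → s + 0ℤ ≡ (s + a) - a
  ring = solve-∀

-- The k-th elementary symmetric function with the variable y left out, when f lists the e_k.
omit : (ℕ → ℤ) → ℤ → ℕ → ℤ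
omit f y zero    = f 0
omit f y (suc k) = f (suc k) - y * omit f y k

-- Each squarefree monomial of degree k+1 arises once for each of its variables singled out as x_c.
-- Since `omit` is defined by division of series, the proof is an induction on the variables.
newton : ∀ x N k → ∑< N (λ c → x c * omit (e x N) (x c) k) ≡ pos (suc k) * e x N (suc k)
newton x zero    k = sym (*-zeroʳ (pos (suc k)))
newton x (suc N) k = begin
  ∑< N (λ c → x c * omit e⁺ (x c) k) + x N * omit e⁺ (x N) k
    -- Leaving out the variable just added undoes the recursion of `e`.
    ≡⟨ cong (λ v → ∑< N (λ c → x c * omit e⁺ (x c) k) + x N * v) (omit-last k) ⟩
  ∑< N (λ c → x c * omit e⁺ (x c) k) + x N * e x N k
    ≡⟨ rest k ⟩
  pos (suc k) * (e x N (suc k) + x N * e x N k) ∎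
  where
  e⁺ : ℕ → ℤ
  e⁺ = e x (suc N)
  omit-last : ∀ k → omit e⁺ (x N) k ≡ e x N k
  omit-last zero    = refl
  omit-last (suc k) = trans (cong (λ v → (e x N (suc k) + x N * e x N k) - x N * v) (omit-last k))
                            (ring (e x N (suc k)) (x N) (e x N k))
    where
    ring : ∀ a y b → (a + y * b) - y * b ≡ a
    ring = solve-∀
  omit-suc : ∀ y k → omit e⁺ y (suc k) ≡ omit (e x N) y (suc k) + x N * omit (e x N) y k
  omit-suc y zero    = ring (e x N 1) (x N) y
    where
    ring : ∀ a b y → (a + b * 1ℤ) - y * 1ℤ ≡ (a - y * 1ℤ) + b * 1ℤ
    ring = solve-∀
  omit-suc y (suc k) = trans (cong (λ v → e⁺ (suc (suc k)) - y * v) (omit-suc y k))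
                             (ring (e x N (suc (suc k))) (x N) (e x N (suc k)) y (omit (e x N) y (suc k)) (omit (e x N) y k))
    where
    ring : ∀ a b c y u v → (a + b * c) - y * (u + b * v) ≡ (a - y * u) + b * (c - y * v)
    ring = solve-∀
  rest : ∀ k → ∑< N (λ c → x c * omit e⁺ (x c) k) + x N * e x N k ≡ pos (suc k) * (e x N (suc k) + x N * e x N k)
  rest zero    = trans (cong (_+ x N * 1ℤ) (newton x N 0)) (ring (e x N 1) (x N))
    where
    ring : ∀ a b → 1ℤ * a + b * 1ℤ ≡ 1ℤ * (a + b * 1ℤ)
    ring = solve-∀
  rest (suc k) = begin
    ∑< N (λ c → x c * omit e⁺ (x c) (suc k)) + x N * e x N (suc k)
      ≡⟨ cong (_+ x N * e x N (suc k)) (begin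
         ∑< N (λ c → x c * omit e⁺ (x c) (suc k))
           ≡⟨ ∑<-cong N (λ c _ → trans (cong (x c *_) (omit-suc (x c) k))
                (ring₁ (x c) (omit (e x N) (x c) (suc k)) (x N) (omit (e x N) (x c) k))) ⟩
         ∑< N (λ c → x c * omit (e x N) (x c) (suc k) + x N * (x c * omit (e x N) (x c) k))
           ≡⟨ trans (∑<-+ N _ _) (cong (∑< N (λ c → x c * omit (e x N) (x c) (suc k)) +_) (∑<-* N (x N) _)) ⟩
         ∑< N (λ c → x c * omit (e x N) (x c) (suc k)) + x N * ∑< N (λ c → x c * omit (e x N) (x c) k)
           ≡⟨ cong₂ (λ u v → u + x N * v) (newton x N (suc k)) (newton x N k) ⟩
         pos (suc (suc k)) * e x N (suc (suc k)) + x N * (pos (suc k) * e x N (suc k)) ∎) ⟩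
    (pos (suc (suc k)) * e x N (suc (suc k)) + x N * (pos (suc k) * e x N (suc k))) + x N * e x N (suc k)
      ≡⟨ ring₂ (pos (suc k)) (e x N (suc (suc k))) (x N) (e x N (suc k)) ⟩
    pos (suc (suc k)) * (e x N (suc (suc k)) + x N * e x N (suc k)) ∎
    where
    ring₁ : ∀ a b c d → a * (b + c * d) ≡ a * b + c * (a * d)
    ring₁ = solve-∀
    ring₂ : ∀ k a b c → ((1ℤ + k) * a + b * (k * c)) + b * c ≡ (1ℤ + k) * (a + b * c)
    ring₂ = solve-∀

module _ (x : ℕ → ℤ) (N : ℕ) where

  -- Proper colourings of n vertices forming a path hanging from a vertex coloured c.
  leg : ℕ → ℕ → ℤ
  leg zero    c = 1ℤ
  leg (suc n) c = ∑< N (λ d → when (not (c ≡ᵇ d)) (x d * leg n d))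

  path : ℕ → ℤ
  path zero    = 1ℤ
  path (suc n) = ∑< N (λ c → x c * leg n c)

  -- The next vertex is coloured freely, which gives a path, and the case that it repeats the colour
  -- `c` is subtracted.
  leg-suc : ∀ n c → c < N → leg (suc n) c ≡ path (suc n) - x c * leg n c
  leg-suc n c = ∑<-exclude N c (λ d → x d * leg n d)

  private
    E : ℕ → ℤ
    E = e x N

  -- By `leg-suc` the series of the legs is P/(1 + x_c z), and the denominator can be cancelled from
  -- E instead.
  conv-leg : ∀ c → c < N → ∀ n → conv E (λ k → x c * leg k c) n ≡ x c * conv (omit E (x c)) path n
  conv-leg c c<N zero    = ring (x c)
    where
    ring : ∀ y → 1ℤ * (y * 1ℤ) ≡ y * (1ℤ * 1ℤ)
    ring = solve-∀
  -- Both sides satisfy u(n+1) = y `conv E path (suc n)` - y u(n), with the same start.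
  conv-leg c c<N (suc n) = trans lhs (trans (cong (λ v → y * conv E path (suc n) + - y * v) (conv-leg c c<N n)) (sym rhs))
    where
    y : ℤ
    y = x c
    lhs : conv E (λ k → y * leg k c) (suc n) ≡ y * conv E path (suc n) + - y * conv E (λ k → y * leg k c) n
    lhs = begin
      conv E (λ k → y * leg k c) (suc n)
        ≡⟨ conv-last E (λ k → y * leg k c) n ⟩
      conv E (λ k → y * leg (suc k) c) n + E (suc n) * (y * 1ℤ)
        ≡⟨ cong (_+ E (suc n) * (y * 1ℤ)) (begin
             conv E (λ k → y * leg (suc k) c) n
               ≡⟨ conv-cong {E} (λ _ → refl) (λ k → trans (cong (y *_) (leg-suc k c c<N)) (ring₁ y (path (suc k)) (leg k c))) n ⟩
             conv E (λ k → y * path (suc k) + - y * (y * leg k c)) n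
               ≡⟨ conv-linearʳ E (λ k → y * path (suc k)) (λ k → y * leg k c) (- y) n ⟩
             conv E (λ k → y * path (suc k)) n + - y * conv E (λ k → y * leg k c) n
               ≡⟨ cong (_+ - y * conv E (λ k → y * leg k c) n) (conv-*ʳ E (path ∘ suc) y n) ⟩
             y * conv E (path ∘ suc) n + - y * conv E (λ k → y * leg k c) n ∎) ⟩
      (y * conv E (path ∘ suc) n + - y * conv E (λ k → y * leg k c) n) + E (suc n) * (y * 1ℤ)
        ≡⟨ ring₂ y (conv E (path ∘ suc) n) (- y * conv E (λ k → y * leg k c) n) (E (suc n)) ⟩
      y * (conv E (path ∘ suc) n + E (suc n) * 1ℤ) + - y * conv E (λ k → y * leg k c) n
        ≡⟨ cong (λ v → y * v + - y * conv E (λ k → y * leg k c) n) (conv-last E path n) ⟨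
      y * conv E path (suc n) + - y * conv E (λ k → y * leg k c) n ∎
      where
      ring₁ : ∀ y p l → y * (p - y * l) ≡ y * p + - y * (y * l)
      ring₁ = solve-∀
      ring₂ : ∀ y a b c → (y * a + b) + c * (y * 1ℤ) ≡ y * (a + c * 1ℤ) + b
      ring₂ = solve-∀
    rhs : y * conv (omit E y) path (suc n) ≡ y * conv E path (suc n) + - y * (y * conv (omit E y) path n)
    rhs = begin
      y * (1ℤ * path (suc n) + conv (λ k → E (suc k) - y * omit E y k) path n)
        ≡⟨ cong (λ v → y * (1ℤ * path (suc n) + v)) (trans
             (conv-cong {g = path} (λ k → ring₁ (E (suc k)) y (omit E y k)) (λ _ → refl) n)
             (conv-linearˡ (E ∘ suc) (omit E y) (- y) path n)) ⟩
      y * (1ℤ * path (suc n) + (conv (E ∘ suc) path n + - y * conv (omit E y) path n))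
        ≡⟨ ring₂ y (path (suc n)) (conv (E ∘ suc) path n) (conv (omit E y) path n) ⟩
      y * conv E path (suc n) + - y * (y * conv (omit E y) path n) ∎
      where
      ring₁ : ∀ a y b → a - y * b ≡ a + - y * b
      ring₁ = solve-∀
      ring₂ : ∀ y p a b → y * (1ℤ * p + (a + - y * b)) ≡ y * (1ℤ * p + a) + - y * (y * b)
      ring₂ = solve-∀

  -- The coefficients of E (P - 1)/z = E' P: `conv-leg` is summed over the colour of the first
  -- vertex, and `newton` evaluates the sum over the left-out variable.
  conv-path : ∀ n → conv E (path ∘ suc) n ≡ conv (λ k → pos (suc k) * E (suc k)) path n
  conv-path n = begin
    conv E (path ∘ suc) n
      ≡⟨ conv-∑ʳ N E (λ k c → x c * leg k c) n ⟩
    ∑< N (λ c → conv E (λ k → x c * leg k c) n)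
      ≡⟨ ∑<-cong N (λ c c<N → trans (conv-leg c c<N n) (conv-*ˡ (x c) (omit E (x c)) path n)) ⟩
    ∑< N (λ c → conv (λ k → x c * omit E (x c) k) path n)
      ≡⟨ conv-∑ˡ N (λ k c → x c * omit E (x c) k) path n ⟩
    conv (λ k → ∑< N (λ c → x c * omit E (x c) k)) path n
      ≡⟨ conv-cong {g = path} (newton x N) (λ _ → refl) n ⟩
    conv (λ k → pos (suc k) * E (suc k)) path n ∎
    where
    conv-*ˡ : ∀ y f g n → y * conv f g n ≡ conv (λ k → y * f k) g n
    conv-*ˡ y f g zero    = sym (*-assoc y (f 0) (g 0))
    conv-*ˡ y f g (suc n) = trans (*-distribˡ-+ y (f 0 * g (suc n)) (conv (f ∘ suc) g n))
      (cong₂ _+_ (sym (*-assoc y (f 0) (g (suc n)))) (conv-*ˡ y (f ∘ suc) g n))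

  -- The factor (i-1) e_i of the recurrence with i = k+1; it is zero at `k = 0`, so the sum
  -- effectively starts at e_2.
  weighted : ℕ → ℤ
  weighted k = pos k * E (suc k)

  path-one : path 1 ≡ E 1
  path-one = begin
    path 1                ≡⟨ *-identityˡ _ ⟨
    1ℤ * path 1           ≡⟨ conv-path 0 ⟩
    1ℤ * E 1 * 1ℤ         ≡⟨ trans (*-identityʳ _) (*-identityˡ _) ⟩
    E 1                   ∎

  -- In `conv-path` the terms with e_1, e_2, ... on the left are moved to the right and lower each
  -- weight from k+1 to k. The top weight is not lowered, since `path ∘ suc` leaves out `path 0`.
  path-rec : ∀ n → path (suc (suc n)) ≡ conv weighted (path ∘ suc) n + pos (suc (suc n)) * E (suc (suc n))
  path-rec n = begin
    path (suc (suc n))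
      ≡⟨ ring₁ (path (suc (suc n))) (conv (E ∘ suc) (path ∘ suc) n) ⟩
    conv E (path ∘ suc) (suc n) - conv (E ∘ suc) (path ∘ suc) n
      ≡⟨ cong (_- conv (E ∘ suc) (path ∘ suc) n) (begin
           conv E (path ∘ suc) (suc n)
             ≡⟨ conv-path (suc n) ⟩
           conv (λ k → pos (suc k) * E (suc k)) path (suc n)
             ≡⟨ conv-last _ path n ⟩
           conv (λ k → pos (suc k) * E (suc k)) (path ∘ suc) n + top * 1ℤ
             ≡⟨ cong (_+ top * 1ℤ) (trans
                  (conv-cong {g = path ∘ suc} (λ k → ring₂ (pos k) (E (suc k))) (λ _ → refl) n)
                  (conv-linearˡ weighted (E ∘ suc) 1ℤ (path ∘ suc) n)) ⟩
           (conv weighted (path ∘ suc) n + 1ℤ * conv (E ∘ suc) (path ∘ suc) n) + top * 1ℤ ∎) ⟩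
    ((conv weighted (path ∘ suc) n + 1ℤ * conv (E ∘ suc) (path ∘ suc) n) + top * 1ℤ) - conv (E ∘ suc) (path ∘ suc) n
      ≡⟨ ring₃ (conv weighted (path ∘ suc) n) (conv (E ∘ suc) (path ∘ suc) n) top ⟩
    conv weighted (path ∘ suc) n + top ∎
    where
    top : ℤ
    top = pos (suc (suc n)) * E (suc (suc n))
    ring₁ : ∀ p c → p ≡ (1ℤ * p + c) - c
    ring₁ = solve-∀
    ring₂ : ∀ k a → (1ℤ + k) * a ≡ k * a + 1ℤ * a
    ring₂ = solve-∀
    ring₃ : ∀ a c t → ((a + 1ℤ * c) + t * 1ℤ) - c ≡ a + t
    ring₃ = solve-∀

  -- `gap j` is D_m with m = j+1.
  gap : ℕ → ℤ
  gap j = pos 2 * (E 1 * path j) - path (suc j)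

  gap-zero : gap 0 ≡ E 1
  gap-zero = trans (cong (λ v → pos 2 * (E 1 * 1ℤ) - v) path-one) (ring (E 1))
    where
    ring : ∀ a → pos 2 * (a * 1ℤ) - a ≡ a
    ring = solve-∀

  hook : ℕ → ℤ
  hook k = E 1 * E (suc k) - E (suc (suc k))

  gap-one : gap 1 ≡ pos 2 * hook 0
  gap-one = trans (cong₂ (λ u v → pos 2 * (E 1 * u) - v) path-one (path-rec 0)) (ring (E 1) (E 2) (path 1))
    where
    ring : ∀ a b p → pos 2 * (a * a) - (0ℤ * a * p + pos 2 * b) ≡ pos 2 * (a * a - b)
    ring = solve-∀

  -- The factor 2 in `gap` makes the boundary terms fit: 2(n+2) copies of e_1 e_{n+2}, less the n+1
  -- copies in the last term of the longer convolution, leave n+3, which is also the coefficient of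
  -- e_{n+3}. Together they form a multiple of `hook`.
  gap-rec : ∀ n → gap (suc (suc n)) ≡ conv weighted (gap ∘ suc) n + pos (suc (suc (suc n))) * hook (suc n)
  gap-rec n = begin
    pos 2 * (E 1 * path (suc (suc n))) - path (suc (suc (suc n)))
      ≡⟨ cong₂ (λ u v → pos 2 * (E 1 * u) - v) (path-rec n) (trans (path-rec (suc n))
           (cong (_+ pos (suc (suc (suc n))) * E (suc (suc (suc n))))
             (trans (conv-last weighted (path ∘ suc) n) (cong (λ v → C₂ + weighted (suc n) * v) path-one)))) ⟩
    pos 2 * (E 1 * (C₁ + pos (suc (suc n)) * E (suc (suc n))))
      - ((C₂ + pos (suc n) * E (suc (suc n)) * E 1) + pos (suc (suc (suc n))) * E (suc (suc (suc n))))
      ≡⟨ ring₁ (pos (suc n)) (E 1) (E (suc (suc n))) (E (suc (suc (suc n)))) C₁ C₂ ⟩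
    (- 1ℤ * C₂ + (pos 2 * E 1) * C₁) + pos (suc (suc (suc n))) * hook (suc n)
      ≡⟨ cong (_+ pos (suc (suc (suc n))) * hook (suc n)) (begin
           - 1ℤ * C₂ + (pos 2 * E 1) * C₁
             ≡⟨ cong (_+ (pos 2 * E 1) * C₁) (conv-*ʳ weighted (path ∘ suc ∘ suc) (- 1ℤ) n) ⟨
           conv weighted (λ j → - 1ℤ * path (suc (suc j))) n + (pos 2 * E 1) * C₁
             ≡⟨ conv-linearʳ weighted (λ j → - 1ℤ * path (suc (suc j))) (path ∘ suc) (pos 2 * E 1) n ⟨
           conv weighted (λ j → - 1ℤ * path (suc (suc j)) + (pos 2 * E 1) * path (suc j)) n
             ≡⟨ conv-cong {weighted} (λ _ → refl) (λ j → ring₂ (path (suc (suc j))) (E 1) (path (suc j))) n ⟩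
           conv weighted (gap ∘ suc) n ∎) ⟩
    conv weighted (gap ∘ suc) n + pos (suc (suc (suc n))) * hook (suc n) ∎
    where
    C₁ C₂ : ℤ
    C₁ = conv weighted (path ∘ suc) n
    C₂ = conv weighted (path ∘ suc ∘ suc) n
    ring₁ : ∀ k a b c u v → pos 2 * (a * (u + (1ℤ + k) * b)) - ((v + k * b * a) + (1ℤ + (1ℤ + k)) * c)
                            ≡ (- 1ℤ * v + (pos 2 * a) * u) + (1ℤ + (1ℤ + k)) * (a * b - c)
    ring₁ = solve-∀
    ring₂ : ∀ p a q → - 1ℤ * p + (pos 2 * a) * q ≡ pos 2 * (a * q) - p
    ring₂ = solve-∀

  -- The spider in terms of paths

  spiderPoly : ℕ → ℤ
  spiderPoly a = ∑< N (λ c → x c * (leg a c * (leg 2 c * leg 1 c)))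

  private
    power : ℕ → ℕ → ℤ
    power zero    c = 1ℤ
    power (suc i) c = x c * power i c

    -- Paths on n+1 vertices with an extra factor x_c^i for the colour c of the first vertex. Paths
    -- and spiders are both polynomials in these quantities, which makes them comparable.
    moment : ℕ → ℕ → ℤ
    moment n i = ∑< N (λ c → power i c * (x c * leg n c))

    moment-zero : ∀ n → moment n 0 ≡ path (suc n)
    moment-zero n = ∑<-cong N (λ c _ → *-identityˡ (x c * leg n c))

    moment-suc : ∀ n i → moment (suc n) i ≡ path (suc n) * moment 0 i - moment n (suc i)
    moment-suc n i = begin
      ∑< N (λ c → power i c * (x c * leg (suc n) c))
        ≡⟨ ∑<-cong N (λ c c<N → trans (cong (λ v → power i c * (x c * v)) (leg-suc n c c<N))
             (ring₁ (power i c) (x c) (path (suc n)) (leg n c))) ⟩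
      ∑< N (λ c → path (suc n) * (power i c * (x c * 1ℤ)) + - 1ℤ * (power (suc i) c * (x c * leg n c)))
        ≡⟨ trans (∑<-+ N _ _) (cong₂ _+_ (∑<-* N (path (suc n)) _) (∑<-* N (- 1ℤ) _)) ⟩
      path (suc n) * moment 0 i + - 1ℤ * moment n (suc i)
        ≡⟨ ring₂ (path (suc n) * moment 0 i) (moment n (suc i)) ⟩
      path (suc n) * moment 0 i - moment n (suc i) ∎
      where
      ring₁ : ∀ w y p l → w * (y * (p - y * l)) ≡ p * (w * (y * 1ℤ)) + - 1ℤ * ((y * w) * (y * l))
      ring₁ = solve-∀
      ring₂ : ∀ a b → a + - 1ℤ * b ≡ a - b
      ring₂ = solve-∀

    path-moment : ∀ n → path (suc (suc n)) ≡ path (suc n) * path 1 - moment n 1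
    path-moment n = trans (sym (moment-zero (suc n))) (trans (moment-suc n 0)
      (cong (λ v → path (suc n) * v - moment n 1) (moment-zero 0)))

    -- The short legs are polynomials in the colour weight y of the centre, p_1 - y and p_2 - p_1 y
    -- + y^2. Their product has degree 3, so moments of the long leg up to order 3 occur.
    spiderPoly-moments : ∀ a → spiderPoly a ≡
      (path 1 * path 2 * path (suc a) + (- (path 1 * path 1 + path 2)) * moment a 1)
        + (pos 2 * path 1 * moment a 2 + - 1ℤ * moment a 3)
    spiderPoly-moments a = begin
      spiderPoly a
        ≡⟨ ∑<-cong N (λ c c<N → trans
             (cong₂ (λ u v → x c * (leg a c * (u * v)))
               (trans (leg-suc 1 c c<N) (cong (λ v → path 2 - x c * v) (leg-suc 0 c c<N))) (leg-suc 0 c c<N))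
             (ring (x c) (leg a c) (path 1) (path 2))) ⟩
      ∑< N (λ c → (path 1 * path 2 * (x c * leg a c) + (- (path 1 * path 1 + path 2)) * (power 1 c * (x c * leg a c)))
        + (pos 2 * path 1 * (power 2 c * (x c * leg a c)) + - 1ℤ * (power 3 c * (x c * leg a c))))
        ≡⟨ trans (∑<-+ N _ _) (cong₂ _+_
             (trans (∑<-+ N _ _) (cong₂ _+_ (∑<-* N (path 1 * path 2) _) (∑<-* N (- (path 1 * path 1 + path 2)) _)))
             (trans (∑<-+ N _ _) (cong₂ _+_ (∑<-* N (pos 2 * path 1) _) (∑<-* N (- 1ℤ) _)))) ⟩
      (path 1 * path 2 * path (suc a) + (- (path 1 * path 1 + path 2)) * moment a 1)
        + (pos 2 * path 1 * moment a 2 + - 1ℤ * moment a 3) ∎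
      where
      ring : ∀ y l p q → y * (l * ((q - y * (p - y * 1ℤ)) * (p - y * 1ℤ)))
        ≡ (p * q * (y * l) + (- (p * p + q)) * ((y * 1ℤ) * (y * l)))
          + (pos 2 * p * ((y * (y * 1ℤ)) * (y * l)) + - 1ℤ * ((y * (y * (y * 1ℤ))) * (y * l)))
      ring = solve-∀

  -- Each vertex added to a path trades a moment for one of higher order, so the long paths are
  -- combinations of `P`, `M₁`, `M₂`, `M₃` with coefficients in `p₁`, `m₁`, `m₂`. Once `path 2` and
  -- `path 3` are rewritten as well, a ring identity remains.
  spiderPoly-paths : ∀ a → spiderPoly a ≡ (path (4 ℕ.+ a) + path 1 * path (3 ℕ.+ a)) - path 3 * path (1 ℕ.+ a)
  spiderPoly-paths a = begin
    spiderPoly a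
      ≡⟨ spiderPoly-moments a ⟩
    (p₁ * path 2 * P + (- (p₁ * p₁ + path 2)) * M₁) + (pos 2 * p₁ * M₂ + - 1ℤ * M₃)
      ≡⟨ cong (λ q → (p₁ * q * P + (- (p₁ * p₁ + q)) * M₁) + (pos 2 * p₁ * M₂ + - 1ℤ * M₃)) path-2 ⟩
    (p₁ * (p₁ * p₁ - m₁) * P + (- (p₁ * p₁ + (p₁ * p₁ - m₁))) * M₁) + (pos 2 * p₁ * M₂ + - 1ℤ * M₃)
      ≡⟨ ring p₁ m₁ m₂ P M₁ M₂ M₃ ⟩
    (p4 + p₁ * p3) - q3 * P
      ≡⟨ cong₂ (λ u v → u - v * P) (cong₂ (λ u v → u + p₁ * v) path-4+a path-3+a) path-3 ⟨
    (path (4 ℕ.+ a) + p₁ * path (3 ℕ.+ a)) - path 3 * P ∎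
    where
    p₁ m₁ m₂ P M₁ M₂ M₃ p2 p3 p4 q3 : ℤ
    p₁ = path 1
    m₁ = moment 0 1
    m₂ = moment 0 2
    P  = path (suc a)
    M₁ = moment a 1
    M₂ = moment a 2
    M₃ = moment a 3
    p2 = P * p₁ - M₁
    p3 = p2 * p₁ - (P * m₁ - M₂)
    p4 = p3 * p₁ - (p2 * m₁ - (P * m₂ - M₃))
    q3 = (p₁ * p₁ - m₁) * p₁ - (p₁ * m₁ - m₂)
    path-2 : path 2 ≡ p₁ * p₁ - m₁
    path-2 = path-moment 0
    path-3 : path 3 ≡ q3
    path-3 = trans (path-moment 1) (cong₂ (λ u v → u * p₁ - v) path-2 (moment-suc 0 1))
    path-3+a : path (3 ℕ.+ a) ≡ p3
    path-3+a = trans (path-moment (suc a)) (cong₂ (λ u v → u * p₁ - v) (path-moment a) (moment-suc a 1))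
    path-4+a : path (4 ℕ.+ a) ≡ p4
    path-4+a = trans (path-moment (2 ℕ.+ a)) (cong₂ (λ u v → u * p₁ - v) path-3+a
      (trans (moment-suc (suc a) 1) (cong₂ (λ u v → u * m₁ - v) (path-moment a) (moment-suc a 2))))
    ring : ∀ p₁ m₁ m₂ P M₁ M₂ M₃ →
      (p₁ * (p₁ * p₁ - m₁) * P + (- (p₁ * p₁ + (p₁ * p₁ - m₁))) * M₁) + (pos 2 * p₁ * M₂ + - 1ℤ * M₃)
      ≡ ((((P * p₁ - M₁) * p₁ - (P * m₁ - M₂)) * p₁ - ((P * p₁ - M₁) * m₁ - (P * m₂ - M₃)))
          + p₁ * ((P * p₁ - M₁) * p₁ - (P * m₁ - M₂)))
        - ((p₁ * p₁ - m₁) * p₁ - (p₁ * m₁ - m₂)) * P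
    ring = solve-∀

  -- Three terms of each long recurrence are split off. Those with weight 0 disappear;
  -- `E 1 * E 2 * path (3 + b)` cancels against `path 3`; `E 3 * path (3 + b)` keeps the coefficient
  -- 2 - 3 = -1 and joins 2 `E 1 * E 3 * path (2 + b)` in `gap`. With a leg of length `2 + b` both
  -- convolutions still have a nonempty rest.
  spiderPoly-expansion : ∀ b → spiderPoly (2 ℕ.+ b) ≡
    ((E 2 * path (4 ℕ.+ b) + E 3 * gap (2 ℕ.+ b))
      + (conv (λ k → weighted (3 ℕ.+ k)) (path ∘ suc) (suc b) + pos (6 ℕ.+ b) * E (6 ℕ.+ b)))
    + (E 1 * conv (λ k → weighted (3 ℕ.+ k)) (path ∘ suc) b + pos (5 ℕ.+ b) * (E 1 * E (5 ℕ.+ b)))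
  spiderPoly-expansion b = begin
    spiderPoly (2 ℕ.+ b)
      ≡⟨ spiderPoly-paths (2 ℕ.+ b) ⟩
    (path (6 ℕ.+ b) + path 1 * path (5 ℕ.+ b)) - path 3 * path (3 ℕ.+ b)
      ≡⟨ cong₂ (λ u v → u - v * path (3 ℕ.+ b))
           (cong₂ _+_ (path-rec (4 ℕ.+ b)) (cong₂ _*_ path-one (path-rec (3 ℕ.+ b))))
           (trans (path-rec 1) (cong (λ v → (0ℤ * E 1 * path 2 + 1ℤ * E 2 * v) + pos 3 * E 3) path-one)) ⟩
    ((0ℤ * E 1 * path (5 ℕ.+ b) + (1ℤ * E 2 * path (4 ℕ.+ b) + (pos 2 * E 3 * path (3 ℕ.+ b) + C₁))
       + pos (6 ℕ.+ b) * E (6 ℕ.+ b))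
      + E 1 * (0ℤ * E 1 * path (4 ℕ.+ b) + (1ℤ * E 2 * path (3 ℕ.+ b) + (pos 2 * E 3 * path (2 ℕ.+ b) + C₂))
       + pos (5 ℕ.+ b) * E (5 ℕ.+ b)))
      - (0ℤ * E 1 * path 2 + 1ℤ * E 2 * E 1 + pos 3 * E 3) * path (3 ℕ.+ b)
      ≡⟨ ring (E 1) (E 2) (E 3) (path 2) (path (2 ℕ.+ b)) (path (3 ℕ.+ b)) (path (4 ℕ.+ b)) (path (5 ℕ.+ b)) C₁ C₂
              (pos (6 ℕ.+ b)) (E (6 ℕ.+ b)) (pos (5 ℕ.+ b)) (E (5 ℕ.+ b)) ⟩
    ((E 2 * path (4 ℕ.+ b) + E 3 * gap (2 ℕ.+ b)) + (C₁ + pos (6 ℕ.+ b) * E (6 ℕ.+ b)))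
      + (E 1 * C₂ + pos (5 ℕ.+ b) * (E 1 * E (5 ℕ.+ b))) ∎
    where
    C₁ C₂ : ℤ
    C₁ = conv (λ k → weighted (3 ℕ.+ k)) (path ∘ suc) (suc b)
    C₂ = conv (λ k → weighted (3 ℕ.+ k)) (path ∘ suc) b
    ring : ∀ e₁ e₂ e₃ q p₂ p₃ p₄ p₅ C D k e₆ l e₅ →
      ((0ℤ * e₁ * p₅ + (1ℤ * e₂ * p₄ + (pos 2 * e₃ * p₃ + C)) + k * e₆)
        + e₁ * (0ℤ * e₁ * p₄ + (1ℤ * e₂ * p₃ + (pos 2 * e₃ * p₂ + D)) + l * e₅))
        - (0ℤ * e₁ * q + 1ℤ * e₂ * e₁ + pos 3 * e₃) * p₃
      ≡ ((e₂ * p₄ + e₃ * (pos 2 * (e₁ * p₂) - p₃)) + (C + k * e₆)) + (e₁ * D + l * (e₁ * e₅))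
    ring = solve-∀

-- Schur positivity

IsPart? : ∀ λs → Dec (IsPart λs)
IsPart? []       = yes tt
IsPart? (a ∷ λs) = (hd λs ℕₚ.≤? a) ×-dec IsPart? λs

record Partition (n : ℕ) (λs : Shape) : Set where
  constructor partition
  field
    decreasing : IsPart λs
    positive   : All (1 ≤_) λs
    size       : sum λs ≡ n

-- `V` as an explicit list of shapes, so that the coefficients of a product appear as multiplicities
-- in a list.
vstrips  : ℕ → Shape → List Shape
vstrips⁻ : ℕ → Shape → List Shape
vstrips k []       = replicate k 1 ∷ []
vstrips k (a ∷ λs) = map (a ∷_) (vstrips k λs) ++ map (suc a ∷_) (vstrips⁻ k λs)
vstrips⁻ zero    λs = []
vstrips⁻ (suc k) λs = vstrips k λs

V-vstrips  : ∀ k λs F → V k F λs ≡ ∑ (vstrips k λs) F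
V⁻-vstrips : ∀ k λs F → V⁻ k F λs ≡ ∑ (vstrips⁻ k λs) F
V-vstrips k []       F = sym (+-identityʳ _)
V-vstrips k (a ∷ λs) F = begin
  V k (F ∘ (a ∷_)) λs + V⁻ k (F ∘ (suc a ∷_)) λs
    ≡⟨ cong₂ _+_ (V-vstrips k λs (F ∘ (a ∷_))) (V⁻-vstrips k λs (F ∘ (suc a ∷_))) ⟩
  ∑ (vstrips k λs) (F ∘ (a ∷_)) + ∑ (vstrips⁻ k λs) (F ∘ (suc a ∷_))
    ≡⟨ cong₂ _+_ (∑-map (a ∷_) (vstrips k λs) F) (∑-map (suc a ∷_) (vstrips⁻ k λs) F) ⟨
  ∑ (map (a ∷_) (vstrips k λs)) F + ∑ (map (suc a ∷_) (vstrips⁻ k λs)) F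
    ≡⟨ ∑-++ (map (a ∷_) (vstrips k λs)) _ F ⟨
  ∑ (vstrips k (a ∷ λs)) F ∎
V⁻-vstrips zero    λs F = refl
V⁻-vstrips (suc k) λs F = V-vstrips k λs F

-- What adding a vertical strip preserves: positive parts and a known size. The order of the parts
-- may break, and such shapes are filtered out because their Schur value is zero.
Composition : ℕ → Shape → Set
Composition n λs = All (1 ≤_) λs × sum λs ≡ n

sum-column : ∀ k → sum (replicate k 1) ≡ k
sum-column zero    = refl
sum-column (suc k) = cong suc (sum-column k)

+-left-comm : ∀ a k s → a ℕ.+ (k ℕ.+ s) ≡ k ℕ.+ (a ℕ.+ s)
+-left-comm a k s = trans (sym (ℕₚ.+-assoc a k s)) (trans (cong (ℕ._+ s) (ℕₚ.+-comm a k)) (ℕₚ.+-assoc k a s))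

vstrips-compositions  : ∀ k λs {n} → Composition n λs → All (Composition (k ℕ.+ n)) (vstrips k λs)
vstrips⁻-compositions : ∀ k a λs {n} → Composition n λs →
                        All (Composition (k ℕ.+ (a ℕ.+ n))) (map (suc a ∷_) (vstrips⁻ k λs))
vstrips-compositions k [] {n} (_ , refl) = (replicate⁺ k ℕₚ.≤-refl , trans (sum-column k) (sym (ℕₚ.+-identityʳ k))) ∷ []
vstrips-compositions k (a ∷ λs) (1≤a ∷ c , refl) = ++⁺
  (map⁺ (All.map (λ { (q , s) → 1≤a ∷ q , trans (cong (a ℕ.+_) s) (+-left-comm a k (sum λs)) }) (vstrips-compositions k λs (c , refl))))
  (vstrips⁻-compositions k a λs (c , refl))
vstrips⁻-compositions zero    a λs c = []
vstrips⁻-compositions (suc k) a λs {n} c = map⁺ (All.map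
  (λ { (q , s) → s≤s z≤n ∷ q , cong suc (trans (cong (a ℕ.+_) s) (+-left-comm a k n)) }) (vstrips-compositions k λs c))

∑-filter-vanishing : ∀ L {F} → Vanishing F → ∑ (filter IsPart? L) F ≡ ∑ L F
∑-filter-vanishing []      v = refl
∑-filter-vanishing (μ ∷ L) {F} v with IsPart? μ
... | yes _ = cong (F μ +_) (∑-filter-vanishing L v)
... | no ¬p = trans (∑-filter-vanishing L v) (sym (trans (cong (_+ ∑ L F) (v μ ¬p)) (+-identityˡ _)))

filter-partitions : ∀ {n} L → All (Composition n) L → All (Partition n) (filter IsPart? L)
filter-partitions []      []             = []
filter-partitions (μ ∷ L) ((q , s) ∷ cs) with IsPart? μ
... | yes p = partition p q s ∷ filter-partitions L cs
... | no _  = filter-partitions L cs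

-- f is a homogeneous symmetric function of degree n, given by its values at all weights x on N variables.
Positive : ℕ → ((ℕ → ℤ) → ℕ → ℤ) → Set
Positive n f = Σ (List Shape) λ L → All (Partition n) L × (∀ x N → f x N ≡ ∑ L (schur x N))

positive-cong : ∀ {n f g} → (∀ x N → f x N ≡ g x N) → Positive n g → Positive n f
positive-cong h (L , p , eq) = L , p , λ x N → trans (h x N) (eq x N)

positive-0 : ∀ {n} → Positive n (λ _ _ → 0ℤ)
positive-0 = [] , [] , λ _ _ → refl

positive-+ : ∀ {n f g} → Positive n f → Positive n g → Positive n (λ x N → f x N + g x N)
positive-+ (L , p , eq) (M , q , eq') =
  L ++ M , ++⁺ p q , λ x N → trans (cong₂ _+_ (eq x N) (eq' x N)) (sym (∑-++ L M (schur x N)))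

positive-scale : ∀ {n f} m → Positive n f → Positive n (λ x N → pos m * f x N)
positive-scale {f = f} zero    p = positive-cong (λ x N → *-zeroˡ (f x N)) positive-0
positive-scale {f = f} (suc m) p = positive-cong (λ x N → ring (pos m) (f x N)) (positive-+ p (positive-scale m p))
  where
  ring : ∀ m a → (1ℤ + m) * a ≡ a + m * a
  ring = solve-∀

-- The Pieri rule is applied to every shape in the list; its strips that fail to be partitions
-- contribute zero and are dropped.
positive-e* : ∀ {n f} k → Positive n f → Positive (k ℕ.+ n) (λ x N → e x N k * f x N)
positive-e* {n} {f} k (L , ps , eq) =
  positive-cong (λ x N → trans (cong (e x N k *_) (eq x N)) (sym (∑-* L (e x N k) (schur x N)))) (go L ps)
  where
  go : ∀ L → All (Partition n) L → Positive (k ℕ.+ n) (λ x N → ∑ L (λ λs → e x N k * schur x N λs))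
  go []       []                           = positive-0
  go (λs ∷ L) (partition d q s ∷ ps) = positive-+
    ( filter IsPart? (vstrips k λs)
    , filter-partitions (vstrips k λs) (vstrips-compositions k λs (q , s))
    , λ x N → trans (pieri x N k λs d) (trans (V-vstrips k λs (schur x N))
                (sym (∑-filter-vanishing (vstrips k λs) (schur-vanishing x N)))))
    (go L ps)

schur-[] : ∀ x N → schur x N [] ≡ 1ℤ
schur-[] x zero    = refl
schur-[] x (suc N) = schur-[] x N

positive-1 : Positive 0 (λ _ _ → 1ℤ)
positive-1 = [] ∷ [] , partition tt [] refl ∷ [] , λ x N → sym (trans (+-identityʳ _) (schur-[] x N))

positive-e : ∀ k → Positive k (λ x N → e x N k)
positive-e k = subst (λ n → Positive n (λ x N → e x N k)) (ℕₚ.+-identityʳ k)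
  (positive-cong (λ x N → sym (*-identityʳ _)) (positive-e* k positive-1))

schur-column : ∀ x N k → e x N k ≡ schur x N (replicate k 1)
schur-column x N k = trans (sym (*-identityʳ _)) (trans (cong (e x N k *_) (sym (schur-[] x N))) (pieri x N k [] tt))

column-IsPart : ∀ a k → 1 ≤ a → IsPart (a ∷ replicate k 1)
column-IsPart a zero    1≤a = z≤n , tt
column-IsPart a (suc k) 1≤a = 1≤a , column-IsPart 1 k ℕₚ.≤-refl

-- Reading e_1 as the Schur function of a single box and multiplying by e_{k+1} leaves just two
-- vertical strips: the column of k+2 boxes, which is e_{k+2} and cancels, and the hook.
positive-hook : ∀ k → Positive (suc (suc k)) (λ x N → hook x N k)
positive-hook k =
  (2 ∷ replicate k 1) ∷ [] ,
  partition (column-IsPart 2 k (s≤s z≤n)) (s≤s z≤n ∷ replicate⁺ k ℕₚ.≤-refl) (cong (suc ∘ suc) (sum-column k)) ∷ [] ,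
  λ x N → begin
    e x N 1 * e x N (suc k) - e x N (suc (suc k))
      ≡⟨ cong₂ _-_ (trans (*-comm (e x N 1) (e x N (suc k))) (trans (cong (e x N (suc k) *_) (schur-column x N 1))
           (pieri x N (suc k) (1 ∷ []) (z≤n , tt)))) (schur-column x N (suc (suc k))) ⟩
    (schur x N (replicate (2 ℕ.+ k) 1) + schur x N (2 ∷ replicate k 1)) - schur x N (replicate (2 ℕ.+ k) 1)
      ≡⟨ ring (schur x N (replicate (2 ℕ.+ k) 1)) (schur x N (2 ∷ replicate k 1)) ⟩
    schur x N (2 ∷ replicate k 1) + 0ℤ ∎
  where
  ring : ∀ a b → (a + b) - a ≡ b + 0ℤ
  ring = solve-∀

positive-conv : ∀ {d} n (f g : ℕ → (ℕ → ℤ) → ℕ → ℤ) →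
  (∀ k j → k ℕ.+ j ≡ n → Positive d (λ x N → f k x N * g j x N)) →
  Positive d (λ x N → conv (λ k → f k x N) (λ j → g j x N) n)
positive-conv zero    f g h = h 0 0 refl
positive-conv (suc n) f g h = positive-+ (h 0 (suc n) refl) (positive-conv n (f ∘ suc) g (λ k j eq → h (suc k) j (cong suc eq)))

positive-weighted* : ∀ {n f} k → Positive n f → Positive (suc k ℕ.+ n) (λ x N → weighted x N k * f x N)
positive-weighted* {f = f} k p =
  positive-cong (λ x N → *-assoc (pos k) (e x N (suc k)) (f x N)) (positive-scale k (positive-e* (suc k) p))

Positive-≡ : ∀ {m n f} → m ≡ n → Positive m f → Positive n f
Positive-≡ refl p = p

positive-path : ∀ n → Positive n (λ x N → path x N n)
positive-path = <-rec _ step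
  where
  step : ∀ n → (∀ {m} → m < n → Positive m (λ x N → path x N m)) → Positive n (λ x N → path x N n)
  step zero          rec = positive-1
  step (suc zero)    rec = positive-cong path-one (positive-e 1)
  step (suc (suc n)) rec = positive-cong (λ x N → path-rec x N n) (positive-+
    (positive-conv n (λ k x N → weighted x N k) (λ j x N → path x N (suc j))
      (λ k j eq → Positive-≡ (trans (cong suc (ℕₚ.+-suc k j)) (cong (suc ∘ suc) eq))
        (positive-weighted* k (rec (s≤s (s≤s (subst (j ≤_) eq (ℕₚ.m≤n+m j k))))))))
    (positive-scale (2 ℕ.+ n) (positive-e (2 ℕ.+ n))))

positive-gap : ∀ n → Positive (suc n) (λ x N → gap x N n)
positive-gap = <-rec _ step
  where
  step : ∀ n → (∀ {m} → m < n → Positive (suc m) (λ x N → gap x N m)) → Positive (suc n) (λ x N → gap x N n)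
  step zero          rec = positive-cong gap-zero (positive-e 1)
  step (suc zero)    rec = positive-cong gap-one (positive-scale 2 (positive-hook 0))
  step (suc (suc n)) rec = positive-cong (λ x N → gap-rec x N n) (positive-+
    (positive-conv n (λ k x N → weighted x N k) (λ j x N → gap x N (suc j))
      (λ k j eq → Positive-≡ (cong suc (trans (ℕₚ.+-suc k (suc j)) (cong suc (trans (ℕₚ.+-suc k j) (cong suc eq)))))
        (positive-weighted* k (rec (s≤s (s≤s (subst (j ≤_) eq (ℕₚ.m≤n+m j k))))))))
    (positive-scale (3 ℕ.+ n) (positive-hook (suc n))))

positive-spider : ∀ b → Positive (6 ℕ.+ b) (λ x N → spiderPoly x N (2 ℕ.+ b))
positive-spider b = positive-cong (λ x N → spiderPoly-expansion x N b) (positive-+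
  (positive-+
    (positive-+ (positive-e* 2 (positive-path (4 ℕ.+ b))) (positive-e* 3 (positive-gap (2 ℕ.+ b))))
    (positive-+ (tail (suc b)) (positive-scale (6 ℕ.+ b) (positive-e (6 ℕ.+ b)))))
  (positive-+ (positive-e* 1 (tail b)) (positive-scale (5 ℕ.+ b) (positive-e* 1 (positive-e (5 ℕ.+ b))))))
  where
  tail : ∀ n → Positive (5 ℕ.+ n) (λ x N → conv (λ k → weighted x N (3 ℕ.+ k)) (λ j → path x N (suc j)) n)
  tail n = positive-conv n (λ k x N → weighted x N (3 ℕ.+ k)) (λ j x N → path x N (suc j))
    (λ k j eq → Positive-≡ (cong (4 ℕ.+_) (trans (ℕₚ.+-suc k j) (cong suc eq)))
      (positive-weighted* (3 ℕ.+ k) (positive-path (suc j))))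

-- Extracting coefficients

number : {A : Set} → (A → Bool) → List A → ℕ
number p xs = length (filterᵇ p xs)

-- A multiset coded as a number whose base-`B` digits are the multiplicities. It serves twice: for
-- the letters of a word, and for the codes of a list of words.
sumPow : ℕ → List ℕ → ℕ
sumPow B []      = 0
sumPow B (k ∷ L) = B ^ k ℕ.+ sumPow B L

-- The effect on the list of dropping the lowest digit of `sumPow`.
preds : List ℕ → List ℕ
preds []          = []
preds (zero ∷ L)  = preds L
preds (suc k ∷ L) = k ∷ preds L

sumPow-split : ∀ B L → sumPow B L ≡ mult L 0 ℕ.+ sumPow B (preds L) ℕ.* B
sumPow-split B []          = refl
sumPow-split B (zero ∷ L)  = cong suc (sumPow-split B L)
sumPow-split B (suc k ∷ L) = trans (cong (B ^ suc k ℕ.+_) (sumPow-split B L)) (begin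
  B ℕ.* B ^ k ℕ.+ (mult L 0 ℕ.+ s ℕ.* B)       ≡⟨ ℕₚ.+-assoc (B ℕ.* B ^ k) (mult L 0) _ ⟨
  (B ℕ.* B ^ k ℕ.+ mult L 0) ℕ.+ s ℕ.* B       ≡⟨ cong (ℕ._+ s ℕ.* B) (ℕₚ.+-comm (B ℕ.* B ^ k) (mult L 0)) ⟩
  (mult L 0 ℕ.+ B ℕ.* B ^ k) ℕ.+ s ℕ.* B       ≡⟨ ℕₚ.+-assoc (mult L 0) _ _ ⟩
  mult L 0 ℕ.+ (B ℕ.* B ^ k ℕ.+ s ℕ.* B)       ≡⟨ cong (λ v → mult L 0 ℕ.+ (v ℕ.+ s ℕ.* B)) (ℕₚ.*-comm B (B ^ k)) ⟩
  mult L 0 ℕ.+ (B ^ k ℕ.* B ℕ.+ s ℕ.* B)       ≡⟨ cong (mult L 0 ℕ.+_) (ℕₚ.*-distribʳ-+ B (B ^ k) s) ⟨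
  mult L 0 ℕ.+ (B ^ k ℕ.+ s) ℕ.* B             ∎)
  where
  s : ℕ
  s = sumPow B (preds L)

mult-≤ : ∀ L k → mult L k ≤ length L
mult-≤ L k = length-filter (λ v → T? (v ≡ᵇ k)) L

length-preds : ∀ L → length (preds L) ≤ length L
length-preds []          = z≤n
length-preds (zero ∷ L)  = ℕₚ.m≤n⇒m≤1+n (length-preds L)
length-preds (suc k ∷ L) = s≤s (length-preds L)

mult-preds : ∀ L k → mult L (suc k) ≡ mult (preds L) k
mult-preds []          k = refl
mult-preds (zero ∷ L)  k = mult-preds L k
mult-preds (suc j ∷ L) k with j ≡ᵇ k
... | true  = cong suc (mult-preds L k)
... | false = mult-preds L k

module _ (B : ℕ) .{{_ : NonZero B}} where

  -- A multiplicity is at most the length of the list, hence smaller than the base, and no carry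
  -- occurs.
  sumPow-% : ∀ L → length L < B → sumPow B L % B ≡ mult L 0
  sumPow-% L l = begin
    sumPow B L % B                                 ≡⟨ cong (_% B) (sumPow-split B L) ⟩
    (mult L 0 ℕ.+ sumPow B (preds L) ℕ.* B) % B    ≡⟨ [m+kn]%n≡m%n (mult L 0) (sumPow B (preds L)) B ⟩
    mult L 0 % B                                   ≡⟨ m<n⇒m%n≡m (ℕₚ.≤-<-trans (mult-≤ L 0) l) ⟩
    mult L 0                                       ∎

  sumPow-/ : ∀ L → length L < B → sumPow B L / B ≡ sumPow B (preds L)
  sumPow-/ L l = begin
    sumPow B L / B                                 ≡⟨ cong (_/ B) (sumPow-split B L) ⟩
    (mult L 0 ℕ.+ sumPow B (preds L) ℕ.* B) / B    ≡⟨ +-distrib-/-∣ʳ (mult L 0) (n∣m*n (sumPow B (preds L))) ⟩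
    mult L 0 / B ℕ.+ sumPow B (preds L) ℕ.* B / B
      ≡⟨ cong₂ ℕ._+_ (m<n⇒m/n≡0 (ℕₚ.≤-<-trans (mult-≤ L 0) l)) (m*n/n≡m (sumPow B (preds L)) B) ⟩
    sumPow B (preds L)                             ∎

  digit : ℕ → ℕ → ℕ
  digit zero    v = v % B
  digit (suc i) v = digit i (v / B)

  digit-sumPow : ∀ i L → length L < B → digit i (sumPow B L) ≡ mult L i
  digit-sumPow zero    L l = sumPow-% L l
  digit-sumPow (suc i) L l = begin
    digit i (sumPow B L / B)       ≡⟨ cong (digit i) (sumPow-/ L l) ⟩
    digit i (sumPow B (preds L))   ≡⟨ digit-sumPow i (preds L) (ℕₚ.≤-<-trans (length-preds L) l) ⟩
    mult (preds L) i               ≡⟨ mult-preds L i ⟨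
    mult L (suc i)                 ∎

  number-preds : ∀ (p : ℕ → Bool) L → number p L ≡ (if p 0 then mult L 0 else 0) ℕ.+ number (p ∘ suc) (preds L)
  number-preds p [] with p 0
  ... | true  = refl
  ... | false = refl
  number-preds p (zero ∷ L) with p 0 | number-preds p L
  ... | true  | ih = cong suc ih
  ... | false | ih = ih
  number-preds p (suc k ∷ L) with p (suc k)
  ... | true  = trans (cong suc (number-preds p L)) (sym (ℕₚ.+-suc (if p 0 then mult L 0 else 0) _))
  ... | false = number-preds p L

  preds-< : ∀ {R} L → All (_< suc R) L → All (_< R) (preds L)
  preds-< []          []             = []
  preds-< (zero ∷ L)  (_ ∷ a)        = preds-< L a
  preds-< (suc k ∷ L) (s≤s k<R ∷ a)  = k<R ∷ preds-< L a

  -- Equal codes have equal digits, so the lists agree as multisets; this is expressed through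
  -- counts, the form in which it is used. The induction is on the bound `R`, because `preds` lowers
  -- the entries but may keep the length.
  sumPow-injective : ∀ R L M → All (_< R) L → All (_< R) M → length L < B → length M < B →
                     sumPow B L ≡ sumPow B M → ∀ p → number p L ≡ number p M
  sumPow-injective R       []      []      _        _        _ _ _  p = refl
  sumPow-injective zero    (_ ∷ _) _       (() ∷ _) _        _ _ _  p
  sumPow-injective zero    []      (_ ∷ _) _        (() ∷ _) _ _ _  p
  sumPow-injective (suc R) L       M       aL       aM       l m eq p = begin
    number p L
      ≡⟨ number-preds p L ⟩
    (if p 0 then mult L 0 else 0) ℕ.+ number (p ∘ suc) (preds L)
      ≡⟨ cong₂ (λ u v → (if p 0 then u else 0) ℕ.+ v)
           (trans (sym (sumPow-% L l)) (trans (cong (_% B) eq) (sumPow-% M m)))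
           (sumPow-injective R (preds L) (preds M) (preds-< L aL) (preds-< M aM)
             (ℕₚ.≤-<-trans (length-preds L) l) (ℕₚ.≤-<-trans (length-preds M) m)
             (trans (sym (sumPow-/ L l)) (trans (cong (_/ B) eq) (sumPow-/ M m))) (p ∘ suc)) ⟩
    (if p 0 then mult M 0 else 0) ℕ.+ number (p ∘ suc) (preds M)
      ≡⟨ number-preds p M ⟨
    number p M ∎

mon-pow : ∀ B M w → mon (λ i → pos (B ^ (M ^ i))) w ≡ pos (B ^ sumPow M w)
mon-pow B M []      = refl
mon-pow B M (c ∷ w) = begin
  pos (B ^ (M ^ c)) * mon (λ i → pos (B ^ (M ^ i))) w  ≡⟨ cong (pos (B ^ (M ^ c)) *_) (mon-pow B M w) ⟩
  pos (B ^ (M ^ c)) * pos (B ^ sumPow M w)             ≡⟨ pos-* (B ^ (M ^ c)) (B ^ sumPow M w) ⟨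
  pos (B ^ (M ^ c) ℕ.* B ^ sumPow M w)                 ≡⟨ cong pos (ℕₚ.^-distribˡ-+-* B (M ^ c) (sumPow M w)) ⟨
  pos (B ^ (M ^ c ℕ.+ sumPow M w))                     ∎

∑-pow : ∀ B M L → ∑ L (mon (λ i → pos (B ^ (M ^ i)))) ≡ pos (sumPow B (map (sumPow M) L))
∑-pow B M []      = refl
∑-pow B M (w ∷ L) = trans (cong₂ _+_ (mon-pow B M w) (∑-pow B M L)) (sym (pos-+ (B ^ sumPow M w) _))

all-cong : ∀ {A : Set} (xs : List A) {p q : A → Bool} → (∀ a → p a ≡ q a) → all p xs ≡ all q xs
all-cong []       h = refl
all-cong (a ∷ xs) h = cong₂ _∧_ (h a) (all-cong xs h)

number-map : ∀ {A B : Set} (p : B → Bool) (q : A → Bool) (h : A → B) L → All (λ a → q a ≡ p (h a)) L →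
             number q L ≡ number p (map h L)
number-map p q h []      []       = refl
number-map p q h (a ∷ L) (eq ∷ eqs) rewrite eq with p (h a)
... | true  = cong suc (number-map p q h L eqs)
... | false = number-map p q h L eqs

bounded : ∀ L {R} → sum L < R → All (_< R) L
bounded []      l = []
bounded (a ∷ L) l = ℕₚ.≤-<-trans (ℕₚ.m≤m+n a _) l ∷ bounded L (ℕₚ.≤-<-trans (ℕₚ.m≤n+m _ a) l)

-- Kronecker substitution x_i = B^(M^i): for large B and M, a polynomial with coefficients in ℕ
-- is determined by this single value, read in base B and its exponents in base M.
content-determined : ∀ (L L' : List (List ℕ)) → (∀ x → ∑ L (mon x) ≡ ∑ L' (mon x)) →
                     ∀ N α → number (hasContent N α) L ≡ number (hasContent N α) L'
content-determined L L' eq N α = begin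
  number (hasContent N α) L        ≡⟨ by-code L (ℕₚ.m≤m+n ℓ ℓ') ⟩
  number decoded (map code L)
    ≡⟨ sumPow-injective B R (map code L) (map code L')
         (bounded (map code L) (s≤s (ℕₚ.m≤m+n (sum (map code L)) _)))
         (bounded (map code L') (s≤s (ℕₚ.m≤n+m (sum (map code L')) _)))
         (s≤s (subst (_≤ length L ℕ.+ length L') (sym (length-map code L)) (ℕₚ.m≤m+n (length L) (length L'))))
         (s≤s (subst (_≤ length L ℕ.+ length L') (sym (length-map code L')) (ℕₚ.m≤n+m (length L') (length L))))
         (+-injective (trans (sym (∑-pow B M L)) (trans (eq _) (∑-pow B M L'))))
         decoded ⟩
  number decoded (map code L')     ≡⟨ by-code L' (ℕₚ.m≤n+m ℓ' ℓ) ⟨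
  number (hasContent N α) L'       ∎
  where
  ℓ ℓ' M B R : ℕ
  ℓ  = sum (map length L)
  ℓ' = sum (map length L')
  -- `M` exceeds the length of every word and `B` the number of words in either list, so neither the
  -- letter counts in base `M` nor the word counts in base `B` can carry.
  M  = suc (ℓ ℕ.+ ℓ')
  B  = suc (length L ℕ.+ length L')
  code : List ℕ → ℕ
  code = sumPow M
  R  = suc (sum (map code L) ℕ.+ sum (map code L'))
  decoded : ℕ → Bool
  decoded v = all (λ i → digit M (toℕ i) v ≡ᵇ α i) (allFin N)
  by-code : ∀ K → sum (map length K) ≤ ℓ ℕ.+ ℓ' → number (hasContent N α) K ≡ number decoded (map code K)
  by-code K l = number-map decoded (hasContent N α) code K
    (All.map (λ {w} lw → all-cong (allFin N) (λ i → cong (_≡ᵇ α i) (sym (digit-sumPow M (toℕ i) w lw))))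
             (map⁻ (bounded (map length K) (s≤s l))))

-- From lists of shapes to coefficients indexed by partitions

_≡ᴸ_ : List ℕ → List ℕ → Bool
[]       ≡ᴸ []       = true
[]       ≡ᴸ (_ ∷ _)  = false
(_ ∷ _)  ≡ᴸ []       = false
(a ∷ as) ≡ᴸ (b ∷ bs) = (a ≡ᵇ b) ∧ (as ≡ᴸ bs)

occurrences : List Shape → Shape → ℕ
occurrences []       μ = 0
occurrences (λs ∷ L) μ = (if λs ≡ᴸ μ then 1 else 0) ℕ.+ occurrences L μ

∑<-pick : ∀ N a (f : ℕ → ℤ) → a < N → ∑< N (λ c → when (a ≡ᵇ c) (f c)) ≡ f a
∑<-pick (suc N) a f (s≤s a≤N) with ℕₚ.m≤n⇒m<n∨m≡n a≤N
... | inj₁ a<N  = trans (cong₂ _+_ (∑<-pick N a f a<N) (when-false (f N) (<⇒≡ᵇ-false a<N))) (+-identityʳ _)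
... | inj₂ refl = trans (cong₂ _+_
  (trans (∑<-cong N (λ c c<N → when-false (f c) (>⇒≡ᵇ-false c<N))) (∑<-0 N)) (when-true (f N) (≡ᵇ-refl N))) (+-identityˡ _)

∑-words-pick : ∀ N k λs (f : Shape → ℤ) → All (_< N) λs →
               ∑ (words N k) (λ μ → when (λs ≡ᴸ μ) (f μ)) ≡ when (length λs ≡ᵇ k) (f λs)
∑-words-pick N zero    []       f a         = +-identityʳ _
∑-words-pick N zero    (_ ∷ _)  f a         = refl
∑-words-pick N (suc k) []       f a         = trans (∑-words-suc N k _) (trans (∑<-cong N (λ c _ → ∑-0 (words N k))) (∑<-0 N))
∑-words-pick N (suc k) (b ∷ λs) f (b<N ∷ a) = begin
  ∑ (words N (suc k)) (λ μ → when ((b ∷ λs) ≡ᴸ μ) (f μ))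
    ≡⟨ ∑-words-suc N k _ ⟩
  ∑< N (λ c → ∑ (words N k) (λ μ → when ((b ≡ᵇ c) ∧ (λs ≡ᴸ μ)) (f (c ∷ μ))))
    ≡⟨ ∑<-cong N (λ c _ → trans (∑-cong (words N k) (λ μ → when-∧ (b ≡ᵇ c) (λs ≡ᴸ μ) _))
         (trans (∑-when (words N k) (b ≡ᵇ c) _) (when-cong (b ≡ᵇ c) (∑-words-pick N k λs (f ∘ (c ∷_)) a)))) ⟩
  ∑< N (λ c → when (b ≡ᵇ c) (when (length λs ≡ᵇ k) (f (c ∷ λs))))
    ≡⟨ ∑<-pick N b _ b<N ⟩
  when (length λs ≡ᵇ k) (f (b ∷ λs)) ∎

weaklyDecr-IsPart : ∀ λs → IsPart λs → weaklyDecr λs ≡ true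
weaklyDecr-IsPart []           p       = refl
weaklyDecr-IsPart (a ∷ [])     p       = refl
weaklyDecr-IsPart (a ∷ b ∷ λs) (l , p) = cong₂ _∧_ (≤⇒≤ᵇ≡true l) (weaklyDecr-IsPart (b ∷ λs) p)

all-positive : ∀ λs → All (1 ≤_) λs → all (λ v → 1 ≤ᵇ v) λs ≡ true
all-positive []       []      = refl
all-positive (a ∷ λs) (l ∷ q) = cong₂ _∧_ (≤⇒≤ᵇ≡true l) (all-positive λs q)

length-≤-sum : ∀ λs → All (1 ≤_) λs → length λs ≤ sum λs
length-≤-sum []       []      = z≤n
length-≤-sum (a ∷ λs) (l ∷ q) = ℕₚ.+-mono-≤ l (length-≤-sum λs q)

-- A partition of n is enumerated exactly once: its parts are at most n, hence letters below n+1,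
-- and it has at most n parts, so precisely one word length matches.
∑-partitions-pick : ∀ n λs (f : Shape → ℤ) → Partition n λs →
                    ∑ (partitions n) (λ μ → when (λs ≡ᴸ μ) (f μ)) ≡ f λs
∑-partitions-pick n λs f (partition d q refl) = begin
  ∑ (partitions n) (λ μ → when (λs ≡ᴸ μ) (f μ))
    ≡⟨ trans (∑-filter (isPartitionOf n) (concatMap (words (suc n)) (upTo (suc n))) (λ μ → when (λs ≡ᴸ μ) (f μ)))
               (∑-concatMap (words (suc n)) (upTo (suc n)) (λ μ → when (isPartitionOf n μ) (when (λs ≡ᴸ μ) (f μ)))) ⟩
  ∑ (upTo (suc n)) (λ k → ∑ (words (suc n) k) (λ μ → when (isPartitionOf n μ) (when (λs ≡ᴸ μ) (f μ))))
    ≡⟨ ∑-upTo (suc n) _ ⟩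
  ∑< (suc n) (λ k → ∑ (words (suc n) k) (λ μ → when (isPartitionOf n μ) (when (λs ≡ᴸ μ) (f μ))))
    ≡⟨ ∑<-cong (suc n) (λ k _ → trans
         (∑-cong (words (suc n) k) (λ μ → when-swap (isPartitionOf n μ) (λs ≡ᴸ μ) (f μ)))
         (∑-words-pick (suc n) k λs _ (bounded λs ℕₚ.≤-refl))) ⟩
  ∑< (suc n) (λ k → when (length λs ≡ᵇ k) (when (isPartitionOf n λs) (f λs)))
    ≡⟨ ∑<-pick (suc n) (length λs) _ (s≤s (length-≤-sum λs q)) ⟩
  when (isPartitionOf n λs) (f λs)
    ≡⟨ when-true (f λs) (cong₂ _∧_ (weaklyDecr-IsPart λs d) (cong₂ _∧_ (all-positive λs q) (≡ᵇ-refl n))) ⟩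
  f λs ∎

pos-sumOver : ∀ xs f → pos (sumOver xs f) ≡ ∑ xs (λ μ → pos (f μ))
pos-sumOver []       f = refl
pos-sumOver (μ ∷ xs) f = trans (pos-+ (f μ) _) (cong (pos (f μ) +_) (pos-sumOver xs f))

-- Each shape of `L` is replaced by an indicator sum over all partitions, and exchanging the sums
-- collects equal shapes.
sumOver-occurrences : ∀ n L → All (Partition n) L → ∀ f →
                      sumOver L f ≡ sumOver (partitions n) (λ μ → occurrences L μ ℕ.* f μ)
sumOver-occurrences n L ps f = +-injective (begin
  pos (sumOver L f)                                              ≡⟨ pos-sumOver L f ⟩
  ∑ L (pos ∘ f)                                                  ≡⟨ go L ps ⟩
  ∑ (partitions n) (λ μ → pos (occurrences L μ ℕ.* f μ))         ≡⟨ pos-sumOver (partitions n) _ ⟨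
  pos (sumOver (partitions n) (λ μ → occurrences L μ ℕ.* f μ))   ∎)
  where
  split : ∀ b m v → pos (((if b then 1 else 0) ℕ.+ m) ℕ.* v) ≡ when b (pos v) + pos (m ℕ.* v)
  split true  m v = pos-+ v (m ℕ.* v)
  split false m v = sym (+-identityˡ _)
  go : ∀ L → All (Partition n) L → ∑ L (pos ∘ f) ≡ ∑ (partitions n) (λ μ → pos (occurrences L μ ℕ.* f μ))
  go []       []       = sym (∑-0 (partitions n))
  go (λs ∷ L) (p ∷ ps) = begin
    pos (f λs) + ∑ L (pos ∘ f)
      ≡⟨ cong₂ _+_ (sym (∑-partitions-pick n λs (pos ∘ f) p)) (go L ps) ⟩
    ∑ (partitions n) (λ μ → when (λs ≡ᴸ μ) (pos (f μ))) + ∑ (partitions n) (λ μ → pos (occurrences L μ ℕ.* f μ))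
      ≡⟨ ∑-+ (partitions n) _ _ ⟨
    ∑ (partitions n) (λ μ → when (λs ≡ᴸ μ) (pos (f μ)) + pos (occurrences L μ ℕ.* f μ))
      ≡⟨ ∑-cong (partitions n) (λ μ → sym (split (λs ≡ᴸ μ) (occurrences L μ) (f μ))) ⟩
    ∑ (partitions n) (λ μ → pos (occurrences (λs ∷ L) μ ℕ.* f μ)) ∎

number-∧ : ∀ {A : Set} (p q : A → Bool) xs → number (λ a → p a ∧ q a) xs ≡ number q (filterᵇ p xs)
number-∧ p q []       = refl
number-∧ p q (a ∷ xs) with p a
... | false = number-∧ p q xs
... | true  with q a
...   | true  = cong suc (number-∧ p q xs)
...   | false = number-∧ p q xs

number-++ : ∀ {A : Set} (p : A → Bool) xs ys → number p (xs ++ ys) ≡ number p xs ℕ.+ number p ys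
number-++ p []       ys = refl
number-++ p (a ∷ xs) ys with p a
... | true  = cong suc (number-++ p xs ys)
... | false = number-++ p xs ys

number-∘ : ∀ {A B : Set} (p : B → Bool) (h : A → B) xs → number (p ∘ h) xs ≡ number p (map h xs)
number-∘ p h []       = refl
number-∘ p h (a ∷ xs) with p (h a)
... | true  = cong suc (number-∘ p h xs)
... | false = number-∘ p h xs

-- Tableaux flattened to words, so that Kostka numbers and colourings both count words of a given
-- content.
readings : ℕ → Shape → List (List ℕ)
readings N λs = map concat (filterᵇ semistandard (fillings N λs))

number-readings : ∀ N α L → number (hasContent N α) (concatMap (readings N) L) ≡ sumOver L (λ λs → kostka λs N α)
number-readings N α []       = refl
number-readings N α (λs ∷ L) = trans (number-++ (hasContent N α) (readings N λs) _) (cong₂ ℕ._+_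
  (trans (sym (number-∘ (hasContent N α) concat (filterᵇ semistandard (fillings N λs))))
         (sym (number-∧ semistandard (λ t → hasContent N α (concat t)) (fillings N λs))))
  (number-readings N α L))

∑-readings : ∀ x N L → ∑ (concatMap (readings N) L) (mon x) ≡ ∑ L (schur x N)
∑-readings x N L = trans (∑-concatMap (readings N) L (mon x))
  (∑-cong L (λ λs → trans (∑-map concat (filterᵇ semistandard (fillings N λs)) (mon x)) (∑-semistandard x N λs)))

-- Proper colourings and tableau readings are two lists of words with the same generating
-- polynomial, hence with equally many words of each content. The list `L` is fixed before the
-- number of variables, as a single family of coefficients requires.
positive⇒SchurPositive : ∀ G {f} → Positive (size G) f →
  (∀ x N → ∑ (filterᵇ (proper G) (words N (size G))) (mon x) ≡ f x N) → SchurPositive G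
positive⇒SchurPositive G {f} (L , ps , expand) chromatic = occurrences L , λ N α → begin
  chromCoeff G N α
    ≡⟨ number-∧ (proper G) (hasContent N α) (words N (size G)) ⟩
  number (hasContent N α) (filterᵇ (proper G) (words N (size G)))
    ≡⟨ content-determined (filterᵇ (proper G) (words N (size G))) (concatMap (readings N) L)
         (λ x → trans (chromatic x N) (trans (expand x N) (sym (∑-readings x N L)))) N α ⟩
  number (hasContent N α) (concatMap (readings N) L)
    ≡⟨ number-readings N α L ⟩
  sumOver L (λ λs → kostka λs N α)
    ≡⟨ sumOver-occurrences (size G) L ps (λ λs → kostka λs N α) ⟩
  sumOver (partitions (size G)) (λ λs → occurrences L λs ℕ.* kostka λs N α) ∎

-- Proper colourings of the spider

T-⇔-≡ : ∀ {p q} → (T p → T q) → (T q → T p) → p ≡ q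
T-⇔-≡ {true}  {true}  f g = refl
T-⇔-≡ {false} {false} f g = refl
T-⇔-≡ {true}  {false} f g = ⊥-elim (f tt)
T-⇔-≡ {false} {true}  f g = ⊥-elim (g tt)

T-not-≡ᵇ : ∀ {m n} → T (not (m ≡ᵇ n)) → m ≢ n
T-not-≡ᵇ {m} t refl = subst (T ∘ not) (≡ᵇ-refl m) t

≢⇒T-not-≡ᵇ : ∀ {m n} → m ≢ n → T (not (m ≡ᵇ n))
≢⇒T-not-≡ᵇ {m} {n} m≢n with m ≡ᵇ n in eq
... | false = tt
... | true  = m≢n (ℕₚ.≡ᵇ⇒≡ m n (subst T (sym eq) tt))

-- The edges of S(a,2,1), each oriented away from the centre.
data Edge (a : ℕ) : ℕ → ℕ → Set where
  start₁ : Edge a 0 1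
  start₂ : Edge a 0 (suc a)
  start₃ : Edge a 0 (suc (a ℕ.+ 2))
  step₁  : ∀ {i} → suc i < a → Edge a (suc i) (suc (suc i))
  step₂  : Edge a (suc a) (suc (suc a))

module _ (a : ℕ) (1≤a : 1 ≤ a) where

  private
    legs : List ℕ
    legs = a ∷ 2 ∷ 1 ∷ []

    n : ℕ
    n = suc (a ℕ.+ 3)

  isStart⇒ : ∀ {v} → T (isStart legs v) → 1 ≡ v ⊎ suc a ≡ v ⊎ suc (a ℕ.+ 2) ≡ v
  isStart⇒ {v} t with to (T-∨ {1 ≡ᵇ v}) t
  ... | inj₁ t₁ = inj₁ (ℕₚ.≡ᵇ⇒≡ 1 v t₁)
  ... | inj₂ t' with to (T-∨ {suc a ≡ᵇ v}) t'
  ...   | inj₁ t₂ = inj₂ (inj₁ (ℕₚ.≡ᵇ⇒≡ (suc a) v t₂))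
  ...   | inj₂ t'' with to (T-∨ {suc (a ℕ.+ 2) ≡ᵇ v}) t''
  ...     | inj₁ t₃ = inj₂ (inj₂ (ℕₚ.≡ᵇ⇒≡ (suc (a ℕ.+ 2)) v t₃))

  isStart⇐ : ∀ {v} → 1 ≡ v ⊎ suc a ≡ v ⊎ suc (a ℕ.+ 2) ≡ v → T (isStart legs v)
  isStart⇐ {v} (inj₁ e₁)        = from (T-∨ {1 ≡ᵇ v}) (inj₁ (ℕₚ.≡⇒≡ᵇ 1 v e₁))
  isStart⇐ {v} (inj₂ (inj₁ e₂)) = from (T-∨ {1 ≡ᵇ v}) (inj₂ (from (T-∨ {suc a ≡ᵇ v}) (inj₁ (ℕₚ.≡⇒≡ᵇ (suc a) v e₂))))
  isStart⇐ {v} (inj₂ (inj₂ e₃)) = from (T-∨ {1 ≡ᵇ v}) (inj₂ (from (T-∨ {suc a ≡ᵇ v}) (inj₂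
    (from (T-∨ {suc (a ℕ.+ 2) ≡ᵇ v}) (inj₁ (ℕₚ.≡⇒≡ᵇ (suc (a ℕ.+ 2)) v e₃))))))

  T-not : ∀ {b} → T (not b) → T b → ⊥
  T-not {true} ()

  not-T : ∀ {b} → (T b → ⊥) → T (not b)
  not-T {true}  f = f tt
  not-T {false} f = tt

  adj⇒Edge : ∀ u v → v < n → T (spiderAdj' legs u v) → Edge a u v
  adj⇒Edge zero v v<n t with to (T-∨ {isStart legs v}) t
  ... | inj₁ s with isStart⇒ {v} s
  ...   | inj₁ refl        = start₁
  ...   | inj₂ (inj₁ refl) = start₂
  ...   | inj₂ (inj₂ refl) = start₃
  adj⇒Edge (suc u) v v<n t with to (T-∧ {v ≡ᵇ suc (suc u)}) t
  ... | v≡ , ns with ℕₚ.≡ᵇ⇒≡ v (suc (suc u)) v≡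
  ...   | refl with ℕₚ.<-cmp (suc u) a
  ...     | tri< u<a _ _   = step₁ u<a
  -- Here `v` would be the first vertex of the second leg, which is joined to the centre only; the
  -- third leg is treated likewise below.
  ...     | tri≈ _ refl _  = ⊥-elim (T-not ns (isStart⇐ (inj₂ (inj₁ refl))))
  ...     | tri> _ _ (s≤s a≤u) with ℕₚ.m≤n⇒m<n∨m≡n a≤u
  ...       | inj₂ refl = step₂
  ...       | inj₁ a<u with ℕₚ.m≤n⇒m<n∨m≡n a<u
  ...         | inj₂ refl = ⊥-elim (T-not ns (isStart⇐ (inj₂ (inj₂ (cong suc (ℕₚ.+-comm a 2))))))
  -- The adjacency formula would continue the last leg beyond its end; the bound `v < n` rules this
  -- out.
  ...         | inj₁ a+1<u = ⊥-elim (ℕₚ.<⇒≱ v<n (s≤s (subst (_≤ suc u) (ℕₚ.+-comm 3 a) (s≤s a+1<u))))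

  Edge⇒adj : ∀ {u v} → Edge a u v → T (spiderAdj' legs u v)
  Edge⇒adj start₁ = tt
  Edge⇒adj start₂ = from (T-∨ {isStart legs (suc a)}) (inj₁ (isStart⇐ (inj₂ (inj₁ refl))))
  Edge⇒adj start₃ = from (T-∨ {isStart legs (suc (a ℕ.+ 2))}) (inj₁ (isStart⇐ (inj₂ (inj₂ refl))))
  Edge⇒adj (step₁ {i} i<a) = from (T-∧ {i ≡ᵇ i}) (ℕₚ.≡⇒≡ᵇ i i refl , not-T (not-start ∘ isStart⇒ {suc (suc i)}))
    where
    not-start : 1 ≡ suc (suc i) ⊎ suc a ≡ suc (suc i) ⊎ suc (a ℕ.+ 2) ≡ suc (suc i) → ⊥
    not-start (inj₂ (inj₁ refl)) = ℕₚ.<-irrefl refl i<a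
    not-start (inj₂ (inj₂ eq))   = ℕₚ.<⇒≱ i<a (subst (a ≤_) (ℕₚ.suc-injective eq) (ℕₚ.m≤m+n a 2))
  Edge⇒adj step₂ = from (T-∧ {a ≡ᵇ a}) (ℕₚ.≡⇒≡ᵇ a a refl , not-T (not-start ∘ isStart⇒ {suc (suc a)}))
    where
    not-start : 1 ≡ suc (suc a) ⊎ suc a ≡ suc (suc a) ⊎ suc (a ℕ.+ 2) ≡ suc (suc a) → ⊥
    not-start (inj₂ (inj₁ eq)) = ℕₚ.1+n≢n (sym eq)
    not-start (inj₂ (inj₂ eq)) = ℕₚ.1+n≢n (trans (ℕₚ.+-comm 2 a) (ℕₚ.suc-injective eq))

  Edge-< : ∀ {u v} → Edge a u v → u < v × v < n
  Edge-< start₁          = s≤s z≤n , s≤s (ℕₚ.≤-trans 1≤a (ℕₚ.m≤m+n a 3))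
  Edge-< start₂          = s≤s z≤n , s≤s (subst (suc a ≤_) (ℕₚ.+-comm 3 a) (s≤s (ℕₚ.m≤n+m a 2)))
  Edge-< start₃          = s≤s z≤n , s≤s (ℕₚ.+-monoʳ-< a (ℕₚ.n<1+n 2))
  Edge-< (step₁ {i} i<a) = ℕₚ.n<1+n (suc i) , s≤s (ℕₚ.≤-trans i<a (ℕₚ.m≤m+n a 3))
  Edge-< step₂           = ℕₚ.n<1+n (suc a) , s≤s (subst (suc (suc a) ≤_) (ℕₚ.+-comm 3 a) (s≤s (s≤s (ℕₚ.n≤1+n a))))

  private
    cell : List ℕ → ℕ → ℕ → Bool
    cell c u v = not (adj (spider legs) u v) ∨ not (at c u ≡ᵇ at c v)

    row : List ℕ → ℕ → Bool
    row c u = all (cell c u) (upTo n)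

  proper⇒ : ∀ c → T (proper (spider legs) c) → ∀ {u v} → Edge a u v → at c u ≢ at c v
  proper⇒ c t {u} {v} edge with Edge-< edge
  ... | u<v , v<n = T-not-≡ᵇ ([ (λ na → ⊥-elim (T-not na adjacent)) , id ] (to (T-∨ {not (adj (spider legs) u v)}) here))
    where
    adjacent : T (adj (spider legs) u v)
    adjacent = from (T-∨ {spiderAdj' legs u v}) (inj₁ (Edge⇒adj edge))
    here : T (cell c u v)
    here = applyUpTo⁻ id n (all⁺ (cell c u) (upTo n) (applyUpTo⁻ id n (all⁺ (row c) (upTo n) t) (ℕₚ.<-trans u<v v<n))) v<n

  proper⇐ : ∀ c → (∀ {u v} → Edge a u v → at c u ≢ at c v) → T (proper (spider legs) c)
  proper⇐ c h = all⁻ (row c) (applyUpTo⁺₁ id n (λ {u} u<n → all⁻ (cell c u) (applyUpTo⁺₁ id n (λ {v} v<n → check u v u<n v<n))))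
    where
    check : ∀ u v → u < n → v < n → T (cell c u v)
    check u v u<n v<n with adj (spider legs) u v in eq
    ... | false = tt
    ... | true  = ≢⇒T-not-≡ᵇ {at c u} {at c v} ([ (λ t → h (adj⇒Edge u v v<n t)) , (λ t → h (adj⇒Edge v u u<n t) ∘ sym) ]
                    (to (T-∨ {spiderAdj' legs u v}) (subst T (sym eq) tt)))

-- Colourings split into legs

chain : ℕ → List ℕ → Bool
chain c []      = true
chain c (d ∷ w) = not (c ≡ᵇ d) ∧ chain d w

chain⇒ : ∀ c w → T (chain c w) → ∀ i → i < length w → at (c ∷ w) i ≢ at w i
chain⇒ c (d ∷ w) t zero    _       = T-not-≡ᵇ (proj₁ (to (T-∧ {not (c ≡ᵇ d)}) t))
chain⇒ c (d ∷ w) t (suc i) (s≤s l) = chain⇒ d w (proj₂ (to (T-∧ {not (c ≡ᵇ d)}) t)) i l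

chain⇐ : ∀ c w → (∀ i → i < length w → at (c ∷ w) i ≢ at w i) → T (chain c w)
chain⇐ c []      h = tt
chain⇐ c (d ∷ w) h = from (T-∧ {not (c ≡ᵇ d)}) (≢⇒T-not-≡ᵇ (h 0 (s≤s z≤n)) , chain⇐ d w (λ i l → h (suc i) (s≤s l)))

at-++ˡ : ∀ u v i → i < length u → at (u ++ v) i ≡ at u i
at-++ˡ (c ∷ u) v zero    _       = refl
at-++ˡ (c ∷ u) v (suc i) (s≤s l) = at-++ˡ u v i l

at-++ʳ : ∀ u v i → at (u ++ v) (length u ℕ.+ i) ≡ at v i
at-++ʳ []      v i = refl
at-++ʳ (c ∷ u) v i = at-++ʳ u v i

-- The labels of each leg are consecutive, so an edge inside a leg compares neighbouring letters of
-- one block, and the edges at the centre compare `c` with the first letter of each block.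
proper-spider : ∀ c u v w → 1 ≤ length u → length v ≡ 2 → length w ≡ 1 →
  proper (spider (length u ∷ 2 ∷ 1 ∷ [])) (c ∷ u ++ (v ++ w)) ≡ chain c u ∧ (chain c v ∧ chain c w)
proper-spider c u (d₁ ∷ d₂ ∷ []) (f ∷ []) 1≤a refl refl = T-⇔-≡
  (λ t → split (proper⇒ a 1≤a colouring t))
  (λ t → proper⇐ a 1≤a colouring (join t))
  where
  a : ℕ
  a = length u
  rest colouring : List ℕ
  rest      = d₁ ∷ d₂ ∷ f ∷ []
  colouring = c ∷ u ++ rest
  at-d₁ : at (u ++ rest) a ≡ d₁
  at-d₁ = trans (cong (at (u ++ rest)) (sym (ℕₚ.+-identityʳ a))) (at-++ʳ u rest 0)
  at-d₂ : at (u ++ rest) (suc a) ≡ d₂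
  at-d₂ = trans (cong (at (u ++ rest)) (ℕₚ.+-comm 1 a)) (at-++ʳ u rest 1)
  at-f : at (u ++ rest) (a ℕ.+ 2) ≡ f
  at-f = at-++ʳ u rest 2
  split : (∀ {i j} → Edge a i j → at colouring i ≢ at colouring j) →
          T (chain c u ∧ (chain c (d₁ ∷ d₂ ∷ []) ∧ chain c (f ∷ [])))
  split h = from (T-∧ {chain c u}) (chain⇐ c u long , from (T-∧ {chain c (d₁ ∷ d₂ ∷ [])})
    ( chain⇐ c (d₁ ∷ d₂ ∷ []) (λ { zero _ eq → h start₂ (trans eq (sym at-d₁))
                                  ; (suc zero) _ eq → h step₂ (trans at-d₁ (trans eq (sym at-d₂)))
                                  ; (suc (suc _)) (s≤s (s≤s ())) })
    , chain⇐ c (f ∷ []) (λ { zero _ eq → h start₃ (trans eq (sym at-f)) ; (suc _) (s≤s ()) })))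
    where
    long : ∀ i → i < a → at (c ∷ u) i ≢ at u i
    long zero    l eq = h start₁ (trans eq (sym (at-++ˡ u rest 0 l)))
    long (suc i) l eq = h (step₁ l) (trans (at-++ˡ u rest i (ℕₚ.<-trans (ℕₚ.n<1+n i) l)) (trans eq (sym (at-++ˡ u rest (suc i) l))))
  join : T (chain c u ∧ (chain c (d₁ ∷ d₂ ∷ []) ∧ chain c (f ∷ []))) →
         ∀ {i j} → Edge a i j → at colouring i ≢ at colouring j
  join t edge with to (T-∧ {chain c u}) t
  ... | tu , t' with to (T-∧ {chain c (d₁ ∷ d₂ ∷ [])}) t'
  ... | tv , tw = go edge
    where
    go : ∀ {i j} → Edge a i j → at colouring i ≢ at colouring j
    go start₁ eq = chain⇒ c u tu 0 1≤a (trans eq (at-++ˡ u rest 0 1≤a))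
    go start₂ eq = chain⇒ c (d₁ ∷ d₂ ∷ []) tv 0 (s≤s z≤n) (trans eq at-d₁)
    go start₃ eq = chain⇒ c (f ∷ []) tw 0 (s≤s z≤n) (trans eq at-f)
    go (step₁ {i} l) eq = chain⇒ c u tu (suc i) l
      (trans (sym (at-++ˡ u rest i (ℕₚ.<-trans (ℕₚ.n<1+n i) l))) (trans eq (at-++ˡ u rest (suc i) l)))
    go step₂ eq = chain⇒ c (d₁ ∷ d₂ ∷ []) tv 1 (s≤s (s≤s z≤n)) (trans (sym at-d₁) (trans eq at-d₂))

∑-words-cong : ∀ N n {f g : List ℕ → ℤ} → (∀ w → length w ≡ n → f w ≡ g w) → ∑ (words N n) f ≡ ∑ (words N n) g
∑-words-cong N zero    h = cong (_+ 0ℤ) (h [] refl)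
∑-words-cong N (suc n) h = trans (∑-words-suc N n _) (trans
  (∑<-cong N (λ c _ → ∑-words-cong N n (λ w l → h (c ∷ w) (cong suc l)))) (sym (∑-words-suc N n _)))

∑-words-++ : ∀ N m n (f : List ℕ → ℤ) → ∑ (words N (m ℕ.+ n)) f ≡ ∑ (words N m) (λ u → ∑ (words N n) (λ v → f (u ++ v)))
∑-words-++ N zero    n f = sym (+-identityʳ _)
∑-words-++ N (suc m) n f = trans (∑-words-suc N (m ℕ.+ n) f) (trans
  (∑<-cong N (λ c _ → ∑-words-++ N m n (f ∘ (c ∷_)))) (sym (∑-words-suc N m _)))

chain-weight : (ℕ → ℤ) → ℕ → List ℕ → ℤ
chain-weight x c w = when (chain c w) (mon x w)

∑-chain : ∀ x N n c → ∑ (words N n) (chain-weight x c) ≡ leg x N n c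
∑-chain x N zero    c = +-identityʳ _
∑-chain x N (suc n) c = trans (∑-words-suc N n (chain-weight x c)) (∑<-cong N (λ d _ → begin
  ∑ (words N n) (λ w → when (not (c ≡ᵇ d) ∧ chain d w) (x d * mon x w))
    ≡⟨ ∑-cong (words N n) (λ w → trans (when-∧ (not (c ≡ᵇ d)) (chain d w) _)
         (when-cong (not (c ≡ᵇ d)) (sym (when-* (chain d w) (x d) (mon x w))))) ⟩
  ∑ (words N n) (λ w → when (not (c ≡ᵇ d)) (x d * chain-weight x d w))
    ≡⟨ ∑-when (words N n) (not (c ≡ᵇ d)) _ ⟩
  when (not (c ≡ᵇ d)) (∑ (words N n) (λ w → x d * chain-weight x d w))
    ≡⟨ when-cong (not (c ≡ᵇ d)) (trans (∑-* (words N n) (x d) _) (cong (x d *_) (∑-chain x N n d))) ⟩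
  when (not (c ≡ᵇ d)) (x d * leg x N n d) ∎))

-- A colouring is cut into the centre's letter and blocks of lengths `a`, 2 and 1. Once the centre
-- is coloured the blocks are independent, so the sum factors.
∑-proper-spider : ∀ a → 1 ≤ a → ∀ x N →
  ∑ (filterᵇ (proper (spider (a ∷ 2 ∷ 1 ∷ []))) (words N (suc (a ℕ.+ 3)))) (mon x) ≡ spiderPoly x N a
∑-proper-spider a 1≤a x N = begin
  ∑ (filterᵇ (proper S) (words N (suc (a ℕ.+ 3)))) (mon x)
    ≡⟨ ∑-filter (proper S) (words N (suc (a ℕ.+ 3))) (mon x) ⟩
  ∑ (words N (suc (a ℕ.+ 3))) term
    ≡⟨ ∑-words-suc N (a ℕ.+ 3) term ⟩
  ∑< N (λ c → ∑ (words N (a ℕ.+ 3)) (term ∘ (c ∷_)))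
    ≡⟨ ∑<-cong N (λ c _ → trans
         (∑-words-++ N a 3 (term ∘ (c ∷_)))
         (∑-cong (words N a) (λ u → ∑-words-++ N 2 1 (λ v → term (c ∷ u ++ v))))) ⟩
  ∑< N (λ c → ∑ (words N a) (λ u → ∑ (words N 2) (λ v → ∑ (words N 1) (λ w → term (c ∷ u ++ (v ++ w))))))
    ≡⟨ ∑<-cong N (λ c _ → ∑-words-cong N a (λ u lu → ∑-words-cong N 2 (λ v lv → ∑-words-cong N 1 (λ w lw →
         factor c u v w lu lv lw)))) ⟩
  ∑< N (λ c → ∑ (words N a) (λ u → ∑ (words N 2) (λ v → ∑ (words N 1) (λ w → x c * (g c u * (g c v * g c w))))))
    ≡⟨ ∑<-cong N (λ c _ → product c) ⟩
  spiderPoly x N a ∎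
  where
  S : Graph
  S = spider (a ∷ 2 ∷ 1 ∷ [])
  term : List ℕ → ℤ
  term w = when (proper S w) (mon x w)
  g : ℕ → List ℕ → ℤ
  g = chain-weight x
  when-product : ∀ p q r s t → when (p ∧ (q ∧ r)) (s * t) ≡ when p s * when q (when r t)
  when-product true  true  r s t = sym (when-* r s t)
  when-product true  false r s t = sym (*-zeroʳ s)
  when-product false q     r s t = refl
  factor : ∀ c u v w → length u ≡ a → length v ≡ 2 → length w ≡ 1 →
           term (c ∷ u ++ (v ++ w)) ≡ x c * (g c u * (g c v * g c w))
  factor c u v w refl lv lw = begin
    when (proper S (c ∷ u ++ (v ++ w))) (x c * mon x (u ++ (v ++ w)))
      ≡⟨ cong₂ when (proper-spider c u v w 1≤a lv lw)
           (cong (x c *_) (trans (mon-++ x u (v ++ w)) (cong (mon x u *_) (mon-++ x v w)))) ⟩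
    when (chain c u ∧ (chain c v ∧ chain c w)) (x c * (mon x u * (mon x v * mon x w)))
      ≡⟨ when-* (chain c u ∧ (chain c v ∧ chain c w)) (x c) _ ⟨
    x c * when (chain c u ∧ (chain c v ∧ chain c w)) (mon x u * (mon x v * mon x w))
      ≡⟨ cong (x c *_) (when-product (chain c u) (chain c v) (chain c w) (mon x u) (mon x v * mon x w)) ⟩
    x c * (g c u * when (chain c v) (when (chain c w) (mon x v * mon x w)))
      ≡⟨ cong (λ t → x c * (g c u * t)) (trans (cong (when (chain c v)) (sym (when-* (chain c w) (mon x v) (mon x w))))
           (when-*ʳ (chain c v) (mon x v) (g c w))) ⟩
    x c * (g c u * (g c v * g c w)) ∎
    where
    when-*ʳ : ∀ b s t → when b (s * t) ≡ when b s * t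
    when-*ʳ true  s t = refl
    when-*ʳ false s t = refl
  product : ∀ c → ∑ (words N a) (λ u → ∑ (words N 2) (λ v → ∑ (words N 1) (λ w → x c * (g c u * (g c v * g c w)))))
                ≡ x c * (leg x N a c * (leg x N 2 c * leg x N 1 c))
  product c = begin
    ∑ (words N a) (λ u → ∑ (words N 2) (λ v → ∑ (words N 1) (λ w → x c * (g c u * (g c v * g c w)))))
      -- Each finished inner sum is moved to the front, where it is a scalar for the next sum
      -- outward.
      ≡⟨ ∑-cong (words N a) (λ u → trans
           (∑-cong (words N 2) (λ v → trans (∑-* (words N 1) (x c) _) (cong (x c *_) (trans (∑-* (words N 1) (g c u) _)
             (cong (g c u *_) (trans (∑-* (words N 1) (g c v) _)
               (trans (cong (g c v *_) (∑-chain x N 1 c)) (*-comm (g c v) (leg x N 1 c)))))))))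
           (trans (∑-* (words N 2) (x c) _) (cong (x c *_) (trans (∑-* (words N 2) (g c u) _)
             (trans (cong (g c u *_) (trans (∑-* (words N 2) (leg x N 1 c) _)
               (trans (cong (leg x N 1 c *_) (∑-chain x N 2 c)) (*-comm (leg x N 1 c) (leg x N 2 c)))))
             (*-comm (g c u) _)))))) ⟩
    ∑ (words N a) (λ u → x c * (leg x N 2 c * leg x N 1 c * g c u))
      ≡⟨ trans (∑-* (words N a) (x c) _) (cong (x c *_) (trans (∑-* (words N a) (leg x N 2 c * leg x N 1 c) (g c))
           (trans (cong (leg x N 2 c * leg x N 1 c *_) (∑-chain x N a c)) (*-comm (leg x N 2 c * leg x N 1 c) (leg x N a c))))) ⟩
    x c * (leg x N a c * (leg x N 2 c * leg x N 1 c)) ∎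

theorem4p3 : (a : ℕ) → 2 ≤ a → SchurPositive (spider (a ∷ 2 ∷ 1 ∷ []))
theorem4p3 (suc (suc b)) (s≤s (s≤s z≤n)) = positive⇒SchurPositive (spider (2 ℕ.+ b ∷ 2 ∷ 1 ∷ []))
  (Positive-≡ (cong (3 ℕ.+_) (ℕₚ.+-comm 3 b)) (positive-spider b))
  (∑-proper-spider (2 ℕ.+ b) (s≤s z≤n))
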